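{- Let $K$ be a quadratic field with embeddings into $\mathbb{R}$ and $\mathbb{Q}_2$, and let $\alpha\in K\setminus\mathbb{Q}$ have property $I$. Let $p_n/q_n$ be the convergents of $\alpha$ obtained from the algorithm described in the context. Then, in $\mathbb{R}$, $$\alpha_\infty=\lim_{n\to\infty}\frac{p_n}{q_n}.$$
   Context: $K$ is a quadratic field with fixed field embeddings $\sigma_\infty:K\to\mathbb{R}$ and $\sigma_2:K\to\mathbb{Q}_2$. For $\alpha\in K$ write $\alpha_\infty=\sigma_\infty(\alpha)$, $\alpha_{\langle 2\rangle}=\sigma_2(\alpha)$. For $u=\sum_{n}c_n2^n\in\mathbb{Q}_2$ with digits $c_n\in\{0,1\}$ ($c_n=0$ for $n<v_2(u)$), put $\lfloor u\rfloor_2=\sum_{n\le 0}c_n2^n\in\mathbb{Z}[1/2]$. Property $I$: $\alpha_\infty\in(-1,1]$ and $v_2(\alpha_{\langle 2\rangle})>0$. For $\alpha\in K^\times$ let $a^{(0)}(\alpha)=2m+\lfloor(1/\alpha)_{\langle 2\rangle}\rfloor_2$, where $m$ is the smallest among the integers $i$ minimizing $|(1/\alpha)_\infty-2i-\lfloor(1/\alpha)_{\langle 2\rangle}\rfloor_2|$; let $a^{(1)}(\alpha)=m'+\lfloor(1/\alpha)_{\langle 2\rangle}\rfloor_2$, where $m'$ is the smallest among the integers $i$ minimizing $|(1/\alpha)_\infty-i-\lfloor(1/\alpha)_{\langle 2\rangle}\rfloor_2|$. Put $T_{2,\epsilon}(\alpha)=\frac1\alpha-a^{(\epsilon)}(\alpha)$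 for $\epsilon\in\{0,1\}$. Algorithm: $\alpha_{(1)}=\alpha$; for $n\ge1$ put $\epsilon=0$ if $n$ is even, $\epsilon=1$ if $n$ is odd, $a_n(\alpha)=a^{(\epsilon)}(\alpha_{(n)})$ and $\alpha_{(n+1)}=T_{2,\epsilon}(\alpha_{(n)})$ (for $\alpha\in K\setminus\mathbb{Q}$ the algorithm never terminates). Convergents: $p_0=0$, $q_0=1$, and for $n\ge1$ $$\begin{pmatrix} p_{n-1} & p_n \\ q_{n-1} & q_n \end{pmatrix}=\begin{pmatrix} 0 & 1 \\ 1 & a_1(\alpha) \end{pmatrix}\cdots\begin{pmatrix} 0 & 1 \\ 1 & a_n(\alpha) \end{pmatrix};$$ $p_n,q_n\in\mathbb{Z}[1/2]$ and $q_n\ne0$. -}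

module Defs where

open import Algebra.Bundles using (CommutativeRing)
open import Algebra.Bundles.Raw using (RawRing)
open import Algebra.Morphism.Structures using (module RingMorphisms)
open import Data.Integer.Base as ℤ using (ℤ; +_; 0ℤ; 1ℤ)
import Data.Integer.Properties as ℤ
open import Data.Integer.Divisibility.Signed
  using (∣m∣n⇒∣m+n; ∣m⇒∣-m; ∣n⇒∣m*n; ∣m⇒∣m*n; divides)
  renaming (_∣_ to _∣ℤ_)
open import Data.Integer.Solver using (module +-*-Solver)
open import Data.Nat.Base as ℕ using (ℕ; zero; suc; parity)
import Data.Nat.Properties as ℕ
open import Data.Parity.Base using (Parity; 0ℙ; 1ℙ)
open import Data.Product.Base using (∃; ∃₂; _×_; _,_)
open import Data.Rational.Base as ℚ using (ℚ; 0ℚ; 1ℚ; ½; ∣_∣)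
import Data.Rational.Properties as ℚ
open import Data.Sum.Base using (inj₁; inj₂)
open import Level using (Level; 0ℓ; _⊔_) renaming (suc to lsuc)
open import Relation.Binary.PropositionalEquality
open import Relation.Nullary using (¬_)
open import Relation.Nullary.Decidable.Core using (dec⇒maybe)
open import Tactic.RingSolver using (solve-∀)
open import Tactic.RingSolver.Core.AlmostCommutativeRing
  using (AlmostCommutativeRing; fromCommutativeRing)

private
  variable
    c ℓ : Level

------------------------------------------------------------------------
-- ℝ, as Cauchy sequences of rationals up to null sequences

IsCauchy : (ℕ → ℚ) → Set
IsCauchy x = ∀ ε → 0ℚ ℚ.< ε →
  ∃ λ N → ∀ m n → N ℕ.≤ m → N ℕ.≤ n → ∣ x m ℚ.- x n ∣ ℚ.< ε

record ℝ : Set where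
  constructor mkℝ
  field
    seq    : ℕ → ℚ
    cauchy : IsCauchy seq

open ℝ public

private
  ℚ-solverRing : AlmostCommutativeRing 0ℓ 0ℓ
  ℚ-solverRing =
    fromCommutativeRing ℚ.+-*-commutativeRing λ q → dec⇒maybe (0ℚ ℚ.≟ q)

  add-back : ∀ p q → p ≡ (p ℚ.- q) ℚ.+ q
  add-back = solve-∀ ℚ-solverRing

  add-cancel : ∀ p q → (p ℚ.+ q) ℚ.- q ≡ p
  add-cancel = solve-∀ ℚ-solverRing

  half-pos : ∀ {ε} → 0ℚ ℚ.< ε → 0ℚ ℚ.< ½ ℚ.* ε
  half-pos {ε} 0<ε =
    subst (ℚ._< ½ ℚ.* ε) (ℚ.*-zeroʳ ½) (ℚ.*-monoʳ-<-pos ½ 0<ε)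

  half+half : ∀ ε → ½ ℚ.* ε ℚ.+ ½ ℚ.* ε ≡ ε
  half+half ε =
    trans (sym (ℚ.*-distribʳ-+ ε ½ ½)) (ℚ.*-identityˡ ε)

  +-cauchy : ∀ {x y} → IsCauchy x → IsCauchy y → IsCauchy (λ n → x n ℚ.+ y n)
  +-cauchy {x} {y} cx cy ε 0<ε
    with M , hM ← cx (½ ℚ.* ε) (half-pos 0<ε)
       | N , hN ← cy (½ ℚ.* ε) (half-pos 0<ε)
    = M ℕ.⊔ N , λ m n m≥ n≥ → begin-strict
      ∣ (x m ℚ.+ y m) ℚ.- (x n ℚ.+ y n) ∣
        ≡⟨ cong ∣_∣ (regroup (x m) (y m) (x n) (y n)) ⟩
      ∣ (x m ℚ.- x n) ℚ.+ (y m ℚ.- y n) ∣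
        ≤⟨ ℚ.∣p+q∣≤∣p∣+∣q∣ (x m ℚ.- x n) (y m ℚ.- y n) ⟩
      ∣ x m ℚ.- x n ∣ ℚ.+ ∣ y m ℚ.- y n ∣
        <⟨ ℚ.+-mono-< (hM m n (ℕ.m⊔n≤o⇒m≤o M N m≥) (ℕ.m⊔n≤o⇒m≤o M N n≥))
                      (hN m n (ℕ.m⊔n≤o⇒n≤o M N m≥) (ℕ.m⊔n≤o⇒n≤o M N n≥)) ⟩
      ½ ℚ.* ε ℚ.+ ½ ℚ.* ε
        ≡⟨ half+half ε ⟩
      ε ∎
    where
    open ℚ.≤-Reasoning
    regroup : ∀ a b c d → (a ℚ.+ b) ℚ.- (c ℚ.+ d) ≡ (a ℚ.- c) ℚ.+ (b ℚ.- d)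
    regroup = solve-∀ ℚ-solverRing

  neg-cauchy : ∀ {x} → IsCauchy x → IsCauchy (λ n → ℚ.- x n)
  neg-cauchy {x} cx ε 0<ε with N , h ← cx ε 0<ε
    = N , λ m n m≥ n≥ → subst (ℚ._< ε)
        (trans (sym (ℚ.∣-p∣≡∣p∣ (x m ℚ.- x n))) (cong ∣_∣ (regroup (x m) (x n))))
        (h m n m≥ n≥)
    where
    regroup : ∀ a b → ℚ.- (a ℚ.- b) ≡ (ℚ.- a) ℚ.- (ℚ.- b)
    regroup = solve-∀ ℚ-solverRing

  tail-bound : ∀ {x} → IsCauchy x →
    ∃₂ λ B N → (0ℚ ℚ.< B) × (∀ n → N ℕ.≤ n → ∣ x n ∣ ℚ.≤ B)
  tail-bound {x} cx with N , h ← cx 1ℚ (ℚ.positive⁻¹ 1ℚ)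
    = 1ℚ ℚ.+ ∣ x N ∣ , N , pos , bound
    where
    open ℚ.≤-Reasoning
    pos : 0ℚ ℚ.< 1ℚ ℚ.+ ∣ x N ∣
    pos = ℚ.+-mono-<-≤ (ℚ.positive⁻¹ 1ℚ) (ℚ.0≤∣p∣ (x N))
    bound : ∀ n → N ℕ.≤ n → ∣ x n ∣ ℚ.≤ 1ℚ ℚ.+ ∣ x N ∣
    bound n n≥ = begin
      ∣ x n ∣
        ≡⟨ cong ∣_∣ (add-back (x n) (x N)) ⟩
      ∣ (x n ℚ.- x N) ℚ.+ x N ∣
        ≤⟨ ℚ.∣p+q∣≤∣p∣+∣q∣ (x n ℚ.- x N) (x N) ⟩
      ∣ x n ℚ.- x N ∣ ℚ.+ ∣ x N ∣
        ≤⟨ ℚ.+-monoˡ-≤ ∣ x N ∣ (ℚ.<⇒≤ (h n N n≥ ℕ.≤-refl)) ⟩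
      1ℚ ℚ.+ ∣ x N ∣ ∎

  scale : ∀ {B ε} → 0ℚ ℚ.< B → 0ℚ ℚ.< ε →
    ∃ λ δ → (0ℚ ℚ.< δ) × (B ℚ.* δ ≡ ε)
  scale {B} {ε} 0<B 0<ε = ℚ.1/_ B ⦃ nz ⦄ ℚ.* ε , pos , eq
    where
    instance
      B-pos : ℚ.Positive B
      B-pos = ℚ.positive 0<B
    nz : ℚ.NonZero B
    nz = ℚ.pos⇒nonZero B
    pos : 0ℚ ℚ.< ℚ.1/_ B ⦃ nz ⦄ ℚ.* ε
    pos = subst (ℚ._< ℚ.1/_ B ⦃ nz ⦄ ℚ.* ε) (ℚ.*-zeroʳ (ℚ.1/_ B ⦃ nz ⦄))
      (ℚ.*-monoʳ-<-pos (ℚ.1/_ B ⦃ nz ⦄) ⦃ ℚ.1/pos⇒pos B ⦄ 0<ε)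
    eq : B ℚ.* (ℚ.1/_ B ⦃ nz ⦄ ℚ.* ε) ≡ ε
    eq = trans (sym (ℚ.*-assoc B _ ε))
      (trans (cong (ℚ._* ε) (ℚ.*-inverseʳ B ⦃ nz ⦄)) (ℚ.*-identityˡ ε))

  mul-bound : ∀ {B δ} a b → 0ℚ ℚ.< B → ∣ a ∣ ℚ.≤ B → ∣ b ∣ ℚ.< δ →
    ∣ a ℚ.* b ∣ ℚ.< B ℚ.* δ
  mul-bound {B} {δ} a b 0<B a≤ b< = begin-strict
    ∣ a ℚ.* b ∣       ≡⟨ ℚ.∣p*q∣≡∣p∣*∣q∣ a b ⟩
    ∣ a ∣ ℚ.* ∣ b ∣   ≤⟨ ℚ.*-monoʳ-≤-nonNeg ∣ b ∣ ⦃ ℚ.nonNegative (ℚ.0≤∣p∣ b) ⦄ a≤ ⟩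
    B ℚ.* ∣ b ∣       <⟨ ℚ.*-monoʳ-<-pos B ⦃ ℚ.positive 0<B ⦄ b< ⟩
    B ℚ.* δ           ∎
    where open ℚ.≤-Reasoning

  product-estimate : ∀ {A B δ η} a b c d → 0ℚ ℚ.< A → 0ℚ ℚ.< B →
    ∣ a ∣ ℚ.≤ A → ∣ d ∣ ℚ.≤ B → ∣ b ℚ.- d ∣ ℚ.< δ → ∣ a ℚ.- c ∣ ℚ.< η →
    ∣ a ℚ.* b ℚ.- c ℚ.* d ∣ ℚ.< A ℚ.* δ ℚ.+ B ℚ.* η
  product-estimate {A} {B} {δ} {η} a b c d 0<A 0<B a≤ d≤ b-d< a-c< = begin-strict
    ∣ a ℚ.* b ℚ.- c ℚ.* d ∣
      ≡⟨ cong ∣_∣ (regroup a b c d) ⟩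
    ∣ a ℚ.* (b ℚ.- d) ℚ.+ d ℚ.* (a ℚ.- c) ∣
      ≤⟨ ℚ.∣p+q∣≤∣p∣+∣q∣ (a ℚ.* (b ℚ.- d)) (d ℚ.* (a ℚ.- c)) ⟩
    ∣ a ℚ.* (b ℚ.- d) ∣ ℚ.+ ∣ d ℚ.* (a ℚ.- c) ∣
      <⟨ ℚ.+-mono-< (mul-bound a (b ℚ.- d) 0<A a≤ b-d<)
                    (mul-bound d (a ℚ.- c) 0<B d≤ a-c<) ⟩
    A ℚ.* δ ℚ.+ B ℚ.* η ∎
    where
    open ℚ.≤-Reasoning
    regroup : ∀ a b c d →
      a ℚ.* b ℚ.- c ℚ.* d ≡ a ℚ.* (b ℚ.- d) ℚ.+ d ℚ.* (a ℚ.- c)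
    regroup = solve-∀ ℚ-solverRing

  *-cauchy : ∀ {x y} → IsCauchy x → IsCauchy y → IsCauchy (λ n → x n ℚ.* y n)
  *-cauchy {x} {y} cx cy ε 0<ε =
    let A , M₁ , 0<A , hA = tail-bound cx
        B , M₂ , 0<B , hB = tail-bound cy
        δ , 0<δ , Aδ = scale 0<A (half-pos 0<ε)
        η , 0<η , Bη = scale 0<B (half-pos 0<ε)
        N₁ , h₁ = cy δ 0<δ
        N₂ , h₂ = cx η 0<η
        M = M₁ ℕ.⊔ M₂
        N = N₁ ℕ.⊔ N₂
    in M ℕ.⊔ N , λ m n m≥ n≥ →
      let m≥N = ℕ.m⊔n≤o⇒n≤o M N m≥
          n≥N = ℕ.m⊔n≤o⇒n≤o M N n≥
      in subst (∣ x m ℚ.* y m ℚ.- x n ℚ.* y n ∣ ℚ.<_)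
           (trans (cong₂ ℚ._+_ Aδ Bη) (half+half ε))
           (product-estimate (x m) (y m) (x n) (y n) 0<A 0<B
             (hA m (ℕ.m⊔n≤o⇒m≤o M₁ M₂ (ℕ.m⊔n≤o⇒m≤o M N m≥)))
             (hB n (ℕ.m⊔n≤o⇒n≤o M₁ M₂ (ℕ.m⊔n≤o⇒m≤o M N n≥)))
             (h₁ m n (ℕ.m⊔n≤o⇒m≤o N₁ N₂ m≥N) (ℕ.m⊔n≤o⇒m≤o N₁ N₂ n≥N))
             (h₂ m n (ℕ.m⊔n≤o⇒n≤o N₁ N₂ m≥N) (ℕ.m⊔n≤o⇒n≤o N₁ N₂ n≥N)))

  abs-cauchy : ∀ {x} → IsCauchy x → IsCauchy (λ n → ∣ x n ∣)
  abs-cauchy {x} cx ε 0<ε with N , h ← cx ε 0<ε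
    = N , λ m n m≥ n≥ → ℚ.≤-<-trans (reverse-triangle (x m) (x n)) (h m n m≥ n≥)
    where
    open ℚ.≤-Reasoning
    one-side : ∀ a b → ∣ a ∣ ℚ.- ∣ b ∣ ℚ.≤ ∣ a ℚ.- b ∣
    one-side a b = begin
      ∣ a ∣ ℚ.- ∣ b ∣
        ≡⟨ cong (λ t → ∣ t ∣ ℚ.- ∣ b ∣)
             (add-back a b) ⟩
      ∣ (a ℚ.- b) ℚ.+ b ∣ ℚ.- ∣ b ∣
        ≤⟨ ℚ.+-monoˡ-≤ (ℚ.- ∣ b ∣) (ℚ.∣p+q∣≤∣p∣+∣q∣ (a ℚ.- b) b) ⟩
      (∣ a ℚ.- b ∣ ℚ.+ ∣ b ∣) ℚ.- ∣ b ∣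
        ≡⟨ add-cancel ∣ a ℚ.- b ∣ ∣ b ∣ ⟩
      ∣ a ℚ.- b ∣ ∎
    swap : ∀ a b → ℚ.- (a ℚ.- b) ≡ b ℚ.- a
    swap = solve-∀ ℚ-solverRing
    reverse-triangle : ∀ a b → ∣ ∣ a ∣ ℚ.- ∣ b ∣ ∣ ℚ.≤ ∣ a ℚ.- b ∣
    reverse-triangle a b with ℚ.∣p∣≡p∨∣p∣≡-p (∣ a ∣ ℚ.- ∣ b ∣)
    ... | inj₁ eq = subst (ℚ._≤ ∣ a ℚ.- b ∣) (sym eq) (one-side a b)
    ... | inj₂ eq = begin
      ∣ ∣ a ∣ ℚ.- ∣ b ∣ ∣     ≡⟨ trans eq (swap ∣ a ∣ ∣ b ∣) ⟩
      ∣ b ∣ ℚ.- ∣ a ∣         ≤⟨ one-side b a ⟩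
      ∣ b ℚ.- a ∣             ≡⟨ cong ∣_∣ (swap a b) ⟨
      ∣ ℚ.- (a ℚ.- b) ∣       ≡⟨ ℚ.∣-p∣≡∣p∣ (a ℚ.- b) ⟩
      ∣ a ℚ.- b ∣             ∎

infix  8 -ᴿ_
infixl 7 _*ᴿ_
infixl 6 _+ᴿ_ _-ᴿ_
infix  4 _≈ᴿ_ _<ᴿ_ _≤ᴿ_

fromℚ : ℚ → ℝ
fromℚ r = mkℝ (λ _ → r) λ ε 0<ε →
  0 , λ _ _ _ _ → subst (λ t → ∣ t ∣ ℚ.< ε) (sym (ℚ.+-inverseʳ r)) 0<ε

_+ᴿ_ _*ᴿ_ : ℝ → ℝ → ℝ
x +ᴿ y = mkℝ (λ n → seq x n ℚ.+ seq y n) (+-cauchy {seq x} {seq y} (cauchy x) (cauchy y))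
x *ᴿ y = mkℝ (λ n → seq x n ℚ.* seq y n) (*-cauchy {seq x} {seq y} (cauchy x) (cauchy y))

-ᴿ_ : ℝ → ℝ
-ᴿ x = mkℝ (λ n → ℚ.- seq x n) (neg-cauchy {seq x} (cauchy x))

_-ᴿ_ : ℝ → ℝ → ℝ
x -ᴿ y = x +ᴿ (-ᴿ y)

∣_∣ᴿ : ℝ → ℝ
∣ x ∣ᴿ = mkℝ (λ n → ∣ seq x n ∣) (abs-cauchy {seq x} (cauchy x))

_≈ᴿ_ _<ᴿ_ _≤ᴿ_ : ℝ → ℝ → Set
x ≈ᴿ y = ∀ ε → 0ℚ ℚ.< ε →
  ∃ λ N → ∀ n → N ℕ.≤ n → ∣ seq x n ℚ.- seq y n ∣ ℚ.< ε
x <ᴿ y = ∃ λ ε → (0ℚ ℚ.< ε) ×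
  ∃ λ N → ∀ n → N ℕ.≤ n → seq x n ℚ.+ ε ℚ.≤ seq y n
x ≤ᴿ y = ¬ (y <ᴿ x)

ℝ-rawRing : RawRing 0ℓ 0ℓ
ℝ-rawRing = record
  { Carrier = ℝ ; _≈_ = _≈ᴿ_ ; _+_ = _+ᴿ_ ; _*_ = _*ᴿ_ ; -_ = -ᴿ_
  ; 0# = fromℚ 0ℚ ; 1# = fromℚ 1ℚ }

infix 4 _⟶_

_⟶_ : (ℕ → ℝ) → ℝ → Set
s ⟶ l = ∀ (ε : ℚ) → 0ℚ ℚ.< ε →
  ∃ λ N → ∀ n → N ℕ.≤ n → ∣ s n -ᴿ l ∣ᴿ <ᴿ fromℚ ε

------------------------------------------------------------------------
-- ℤ₂ = lim ℤ/2ⁿ; res n is any integer representing the class modulo 2ⁿ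

2^_ : ℕ → ℤ
2^ n = + (2 ℕ.^ n)


record ℤ₂ : Set where
  constructor mkℤ₂
  field
    res      : ℕ → ℤ
    coherent : ∀ n → 2^ n ∣ℤ res (suc n) ℤ.- res n

open ℤ₂ public

infix  8 -ᶻ_
infixl 7 _*ᶻ_
infixl 6 _+ᶻ_
infix  4 _≈ᶻ_

_≈ᶻ_ : ℤ₂ → ℤ₂ → Set
x ≈ᶻ y = ∀ n → 2^ n ∣ℤ res x n ℤ.- res y n

fromℤ : ℤ → ℤ₂
fromℤ i = mkℤ₂ (λ _ → i) λ n → divides 0ℤ (ℤ.+-inverseʳ i)

_+ᶻ_ _*ᶻ_ : ℤ₂ → ℤ₂ → ℤ₂
x +ᶻ y = mkℤ₂ (λ n → res x n ℤ.+ res y n) λ n →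
  subst (2^ n ∣ℤ_) (regroup (res x (suc n)) (res x n) (res y (suc n)) (res y n))
    (∣m∣n⇒∣m+n (coherent x n) (coherent y n))
  where
  regroup : ∀ a b c d → (a ℤ.- b) ℤ.+ (c ℤ.- d) ≡ (a ℤ.+ c) ℤ.- (b ℤ.+ d)
  regroup = solve 4 (λ a b c d →
    (a :- b) :+ (c :- d) := (a :+ c) :- (b :+ d)) refl
    where open +-*-Solver
x *ᶻ y = mkℤ₂ (λ n → res x n ℤ.* res y n) λ n →
  subst (2^ n ∣ℤ_) (regroup (res x (suc n)) (res x n) (res y (suc n)) (res y n))
    (∣m∣n⇒∣m+n (∣m⇒∣m*n (res y (suc n)) (coherent x n))
               (∣n⇒∣m*n (res x n) (coherent y n)))
  where
  regroup : ∀ a b c d →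
    (a ℤ.- b) ℤ.* c ℤ.+ b ℤ.* (c ℤ.- d) ≡ a ℤ.* c ℤ.- b ℤ.* d
  regroup = solve 4 (λ a b c d →
    (a :- b) :* c :+ b :* (c :- d) := a :* c :- b :* d) refl
    where open +-*-Solver

-ᶻ_ : ℤ₂ → ℤ₂
-ᶻ x = mkℤ₂ (λ n → ℤ.- res x n) λ n →
  subst (2^ n ∣ℤ_) (regroup (res x (suc n)) (res x n)) (∣m⇒∣-m (coherent x n))
  where
  regroup : ∀ a b → ℤ.- (a ℤ.- b) ≡ (ℤ.- a) ℤ.- (ℤ.- b)
  regroup = solve 2 (λ a b → :- (a :- b) := (:- a) :- (:- b)) refl
    where open +-*-Solver

------------------------------------------------------------------------
-- ℚ₂ = ℤ₂[1/2]; x /2^ k is the fraction x / 2ᵏ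

infix 5 _/2^_

record ℚ₂ : Set where
  constructor _/2^_
  field
    num : ℤ₂
    exp : ℕ

ℚ₂-rawRing : RawRing 0ℓ 0ℓ
ℚ₂-rawRing = record
  { Carrier = ℚ₂
  ; _≈_ = λ { (x /2^ k) (y /2^ l) → fromℤ (2^ l) *ᶻ x ≈ᶻ fromℤ (2^ k) *ᶻ y }
  ; _+_ = λ { (x /2^ k) (y /2^ l) →
              fromℤ (2^ l) *ᶻ x +ᶻ fromℤ (2^ k) *ᶻ y /2^ k ℕ.+ l }
  ; _*_ = λ { (x /2^ k) (y /2^ l) → x *ᶻ y /2^ k ℕ.+ l }
  ; -_ = λ { (x /2^ k) → -ᶻ x /2^ k }
  ; 0# = fromℤ 0ℤ /2^ 0
  ; 1# = fromℤ 1ℤ /2^ 0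
  }

-- The digits dᵢ ∈ {0,1} with x = Σ dᵢ 2ⁱ: the residue of x in [0, 2ⁱ⁺¹)
-- is d₀ + 2 d₁ + ⋯ + 2ⁱ dᵢ.
digit : ℤ₂ → ℕ → ℕ
digit x i = ℕ._/_ (ℤ._%ℕ_ (res x (suc i)) (2 ℕ.^ suc i) ⦃ ℕ.m^n≢0 2 (suc i) ⦄)
                  (2 ℕ.^ i) ⦃ ℕ.m^n≢0 2 i ⦄

digitSum : ℤ₂ → ℕ → ℕ
digitSum x zero    = 0
digitSum x (suc j) = digitSum x j ℕ.+ digit x j ℕ.* 2 ℕ.^ j

-- If x = Σ dᵢ 2ⁱ then the n-th digit of x / 2ᵏ is dₙ₊ₖ, so the digits with
-- n ≤ 0 are d₀, …, dₖ.
⌊_⌋₂ : ℚ₂ → ℚ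
⌊ x /2^ k ⌋₂ = ℚ._/_ (+ digitSum x (suc k)) (2 ℕ.^ k) ⦃ ℕ.m^n≢0 2 k ⦄

-- v₂(x / 2ᵏ) > 0, that is v₂(x) ≥ k + 1.
PositiveValuation : ℚ₂ → Set
PositiveValuation (x /2^ k) = 2^ suc k ∣ℤ res x (suc k)

record IsField (R : CommutativeRing c ℓ) : Set (c ⊔ ℓ) where
  open CommutativeRing R
  field
    1≉0     : ¬ 1# ≈ 0#
    inverse : ∀ x → ¬ x ≈ 0# → ∃ λ y → x * y ≈ 1#

record QuadraticField c ℓ : Set (lsuc (c ⊔ ℓ)) where
  field
    commutativeRing : CommutativeRing c ℓ
    isField         : IsField commutativeRing

  open CommutativeRing commutativeRing public
  open RingMorphisms ℚ.+-*-rawRing rawRing using (IsRingHomomorphism)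

  field
    ι     : ℚ → Carrier
    ι-hom : IsRingHomomorphism ι

    -- [K : ℚ] = 2
    e₁ e₂       : Carrier
    spanning    : ∀ x → ∃₂ λ r s → x ≈ ι r * e₁ + ι s * e₂
    independent : ∀ r s → ι r * e₁ + ι s * e₂ ≈ 0# → r ≡ 0ℚ × s ≡ 0ℚ

  IsRational : Carrier → Set ℓ
  IsRational x = ∃ λ r → x ≈ ι r

RealEmbedding : (K : QuadraticField c ℓ) → (QuadraticField.Carrier K → ℝ) → Set (c ⊔ ℓ)
RealEmbedding K = IsRingMonomorphism
  where open RingMorphisms (QuadraticField.rawRing K) ℝ-rawRing

2-AdicEmbedding : (K : QuadraticField c ℓ) → (QuadraticField.Carrier K → ℚ₂) → Set (c ⊔ ℓ)
2-AdicEmbedding K = IsRingMonomorphism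
  where open RingMorphisms (QuadraticField.rawRing K) ℚ₂-rawRing

IsMinimizer : (ℤ → ℝ) → ℤ → Set
IsMinimizer f m = ∀ i → f m ≤ᴿ f i

IsSmallestMinimizer : (ℤ → ℝ) → ℤ → Set
IsSmallestMinimizer f m = IsMinimizer f m × (∀ i → IsMinimizer f i → m ℤ.≤ i)

fromInt : ℤ → ℚ
fromInt i = i ℚ./ 1

module Algorithm (K : QuadraticField c ℓ)
                 (σ∞ : QuadraticField.Carrier K → ℝ)
                 (σ₂ : QuadraticField.Carrier K → ℚ₂) where
  open QuadraticField K

  record PropertyI (α : Carrier) : Set where
    field
      -1<α∞   : fromℚ (ℚ.- 1ℚ) <ᴿ σ∞ α
      α∞≤1    : σ∞ α ≤ᴿ fromℚ 1ℚ
      v₂α>0   : PositiveValuation (σ₂ α)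

  stride : Parity → ℤ
  stride 0ℙ = + 2
  stride 1ℙ = + 1

  -- Step ε α a α′ says a = a^(ε)(α) and α′ = T_{2,ε}(α); the recip field is
  -- 1/α, so the existence of a step forces α ≠ 0.
  record Step (ε : Parity) (α : Carrier) (a : ℚ) (α′ : Carrier) : Set (c ⊔ ℓ) where
    field
      recip     : Carrier
      α*recip≈1 : α * recip ≈ 1#

    ⌊recip⌋ : ℚ
    ⌊recip⌋ = ⌊ σ₂ recip ⌋₂

    distance : ℤ → ℝ
    distance i =
      ∣ σ∞ recip -ᴿ fromℚ (fromInt (stride ε ℤ.* i)) -ᴿ fromℚ ⌊recip⌋ ∣ᴿ

    field
      m          : ℤ
      m-smallest : IsSmallestMinimizer distance m
      a-def      : a ≡ fromInt (stride ε ℤ.* m) ℚ.+ ⌊recip⌋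
      α′-def     : α′ ≈ recip - ι a

  -- The sequences aₙ(α) and α₍ₙ₎, n ≥ 1; their entries at 0 play no role.
  record IsExpansion (α : Carrier) (a : ℕ → ℚ) (α₍_₎ : ℕ → Carrier) : Set (c ⊔ ℓ) where
    field
      start : α₍ 1 ₎ ≈ α
      step  : ∀ n → 1 ℕ.≤ n → Step (parity n) α₍ n ₎ (a n) α₍ suc n ₎

record Mat₂ : Set where
  constructor mat
  field
    m₁₁ m₁₂ m₂₁ m₂₂ : ℚ

_⊗_ : Mat₂ → Mat₂ → Mat₂
mat a b c d ⊗ mat a′ b′ c′ d′ =
  mat (a ℚ.* a′ ℚ.+ b ℚ.* c′) (a ℚ.* b′ ℚ.+ b ℚ.* d′)
      (c ℚ.* a′ ℚ.+ d ℚ.* c′) (c ℚ.* b′ ℚ.+ d ℚ.* d′)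

-- The product over 1 ≤ i ≤ n; its second column is (pₙ, qₙ), which for the
-- empty product is (0, 1).
convergentMatrix : (ℕ → ℚ) → ℕ → Mat₂
convergentMatrix a zero    = mat 1ℚ 0ℚ 0ℚ 1ℚ
convergentMatrix a (suc n) = convergentMatrix a n ⊗ mat 0ℚ 1ℚ 1ℚ (a (suc n))

numer denom : (ℕ → ℚ) → ℕ → ℚ
numer a n = Mat₂.m₁₂ (convergentMatrix a n)
denom a n = Mat₂.m₂₂ (convergentMatrix a n)

{-# OPTIONS --safe #-}
module Submission where

open import Defs
open import Algebra.Bundles.Raw using (RawRing)
open import Algebra.Morphism.Structures using (module RingMorphisms)
import Algebra.Solver.Ring
import Algebra.Solver.Ring.AlmostCommutativeRing as ACR
open import Data.Integer.Base as ℤ using (ℤ; +_; -[1+_]; 0ℤ; 1ℤ)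
open import Data.Integer.Divisibility.Signed as Div
  using (∣m∣n⇒∣m+n; ∣m∣n⇒∣m-n; ∣m⇒∣-m; ∣n⇒∣m*n; ∣m⇒∣m*n; divides)
  renaming (_∣_ to _∣ℤ_)
import Data.Integer.DivMod as ℤ
import Data.Integer.Properties as ℤ
import Data.Integer.Solver
open Data.Integer.Solver.+-*-Solver using ()
  renaming (solve to ℤ-solve; _:+_ to _⊕_; _:-_ to _⊝_; _:=_ to _⊜_)
import Data.Maybe.Base as Maybe
open import Data.Nat.Base as ℕ using (ℕ; zero; suc; parity)
import Data.Nat.DivMod as ℕ
import Data.Nat.Divisibility as ℕ
import Data.Nat.Properties as ℕ
open import Data.Parity.Base using (Parity; 0ℙ; 1ℙ)
open import Data.Product.Base using (Σ; ∃; ∃₂; _×_; _,_; proj₁; proj₂)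
open import Data.Rational.Base as ℚ using (ℚ; 0ℚ; 1ℚ; ½; ∣_∣; NonZero; _÷_; toℚᵘ)
import Data.Rational.Properties as ℚ
open import Data.Rational.Unnormalised.Base as ℚᵘ using (mkℚᵘ; *≡*; *≤*)
import Data.Rational.Unnormalised.Properties as ℚᵘ
open import Data.Sum.Base using (_⊎_; inj₁; inj₂)
open import Level using (Level; 0ℓ)
import Relation.Binary.PropositionalEquality as ≡
open ≡ using (_≡_; cong; cong₂; subst; subst₂)
import Relation.Binary.Reasoning.Setoid
open import Relation.Nullary using (¬_; contradiction; yes; no)
open import Relation.Nullary.Decidable.Core using (dec⇒maybe)
open import Tactic.RingSolver using (solve-∀)
open import Tactic.RingSolver.Core.AlmostCommutativeRing
  using (AlmostCommutativeRing; fromCommutativeRing)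

-- With gₙ = qₙ α - pₙ = ± α₍₁₎ ⋯ α₍ₙ₊₁₎, the bounds |α₍ᵢ₎| ≤ 1, and ≤ 1/2 for
-- even i, give |gₙ| ≤ bₙ with bₙ → 0.  This alone does not make pₙ / qₙ converge,
-- since qₙ might be small.  But all α₍ᵢ₎ are 2-adic integers, so that gₙ qₙ and
-- gₙ pₙ are 2-adically integral, by induction on n from α₍ₙ₎ aₙ = 1 - α₍ₙ₎ α₍ₙ₊₁₎.
-- Let t be the trace of α.  The norm (qₙ α - pₙ)(qₙ (t - α) - pₙ) is then a nonzero
-- element of ℤ[1/2] ∩ ℤ₂ = ℤ up to a fixed denominator, and hence bounded below, so
-- that 1 ≤ C bₙ (T |qₙ| + bₙ) with T = |t - 2α|.  Thus |qₙ| → ∞, and moreover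
-- |α - pₙ / qₙ| ≤ bₙ / |qₙ| → 0.  Finally qₙ ≠ 0 for all n, because one of α₍ₙ₎ and
-- α₍ₙ₊₁₎ is even, and therefore gₙ₋₁ qₙ is a 2-adic unit.

-- The two kinds of step trade a real gain against a 2-adic one. `⌊_⌋₂` keeps the digits up to
-- position 0, so removing it from 1/α leaves an even 2-adic integer. Subtracting a multiple of 2
-- preserves evenness but only confines the real remainder to absolute value 1; subtracting an
-- arbitrary integer improves this to 1/2 at the price of evenness. Property I has the shape of the
-- outcome of an even step, so `α` itself fits into the alternation. Of two consecutive quotients,
-- one thus supplies the factor 1/2 that makes bₙ decay and the other the factor 2 that keeps qₙ
-- nonzero. Since pₙ and qₙ may have powers of 2 in their denominators, the integrality of the norm
-- is not visible factor by factor: gₙ has to be distributed over its conjugate, which is linear in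
-- pₙ and qₙ. Conjugation is not set up as an automorphism; t - α stands in for the conjugate, and α
-- (t - α) = ν turns the norm into a polynomial in pₙ, qₙ, t and ν, where the denominators of t and
-- ν do not depend on n.

private variable c ℓ : Level

-- Congruences in ℚ₂ modulo powers of 2

module 2-Adic where
  open Data.Integer.Solver.+-*-Solver using (solve; _:+_; _:*_; _:-_; :-_; _:=_; con)

  2^-nonZero : ∀ n → ℤ.NonZero (2^ n)
  2^-nonZero n = ℕ.m^n≢0 2 n

  2^-+ : ∀ m n → 2^ (m ℕ.+ n) ≡ 2^ m ℤ.* 2^ n
  2^-+ m n = ≡.trans (cong +_ (ℕ.^-distribˡ-+-* 2 m n)) (ℤ.pos-* (2 ℕ.^ m) (2 ℕ.^ n))

  2^-mono-∣ : ∀ {m n} → m ℕ.≤ n → 2^ m ∣ℤ 2^ n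
  2^-mono-∣ {m} {n} m≤n = divides (2^ (n ℕ.∸ m))
    (≡.trans (cong 2^_ (≡.sym (ℕ.m∸n+n≡m m≤n))) (2^-+ (n ℕ.∸ m) m))

  2^-resp-∣ : ∀ {m n x} → m ≡ n → 2^ m ∣ℤ x → 2^ n ∣ℤ x
  2^-resp-∣ ≡.refl d = d

  *-pres-∣ : ∀ {a b c d} → a ∣ℤ b → c ∣ℤ d → a ℤ.* c ∣ℤ b ℤ.* d
  *-pres-∣ {a} {c = c} (divides p ≡.refl) (divides q ≡.refl) = divides (p ℤ.* q)
    (solve 4 (λ p a q c → (p :* a) :* (q :* c) := (p :* q) :* (a :* c)) ≡.refl p a q c)

  2^-*-∣ : ∀ m n {x} → 2^ n ∣ℤ x → 2^ (m ℕ.+ n) ∣ℤ 2^ m ℤ.* x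
  2^-*-∣ m n {x} d = subst (_∣ℤ 2^ m ℤ.* x) (≡.sym (2^-+ m n)) (Div.*-monoʳ-∣ (2^ m) d)

  2^-cancel-∣ : ∀ m n {x} → 2^ (m ℕ.+ n) ∣ℤ 2^ m ℤ.* x → 2^ n ∣ℤ x
  2^-cancel-∣ m n {x} d = Div.*-cancelˡ-∣ (2^ m) {{2^-nonZero m}}
    (subst (_∣ℤ 2^ m ℤ.* x) (2^-+ m n) d)

  coherent-≤ : ∀ x {m n} → m ℕ.≤ n → 2^ m ∣ℤ res x n ℤ.- res x m
  coherent-≤ x {m} {n} m≤n = go (ℕ.≤⇒≤′ m≤n)
    where
    go : ∀ {n} → m ℕ.≤′ n → 2^ m ∣ℤ res x n ℤ.- res x m
    go ℕ.≤′-refl = divides 0ℤ (ℤ.+-inverseʳ (res x m))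
    go (ℕ.≤′-step {n} p) = subst (2^ m ∣ℤ_)
      (solve 3 (λ a b c → (a :- b) :+ (b :- c) := a :- c) ≡.refl
        (res x (suc n)) (res x n) (res x m))
      (∣m∣n⇒∣m+n (Div.∣-trans (2^-mono-∣ (ℕ.≤′⇒≤ p)) (coherent x n)) (go p))

  -- u ≡₂ z [ N ]: the 2-adic number u is congruent to the integer z modulo 2ᴺ.
  infix 4 _≡₂_[_]

  _≡₂_[_] : ℚ₂ → ℤ → ℕ → Set
  x /2^ k ≡₂ z [ N ] = 2^ (N ℕ.+ k) ∣ℤ res x (N ℕ.+ k) ℤ.- 2^ k ℤ.* z

  -- The definition looks at the numerator at index N + k, while sums and products combine fractions
  -- with different denominators. Coherence lets any later index stand in for that one.
  ≡₂-raise : ∀ {x k z N M} → N ℕ.+ k ℕ.≤ M →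
    x /2^ k ≡₂ z [ N ] → 2^ (N ℕ.+ k) ∣ℤ res x M ℤ.- 2^ k ℤ.* z
  ≡₂-raise {x} {k} {z} {N} {M} le h = subst (2^ (N ℕ.+ k) ∣ℤ_)
    (solve 3 (λ a b c → (a :- b) :+ (b :- c) := a :- c) ≡.refl
      (res x M) (res x (N ℕ.+ k)) (2^ k ℤ.* z))
    (∣m∣n⇒∣m+n (coherent-≤ x le) h)

  ≡₂-lower : ∀ {x k z N M} → N ℕ.+ k ℕ.≤ M →
    2^ (N ℕ.+ k) ∣ℤ res x M ℤ.- 2^ k ℤ.* z → x /2^ k ≡₂ z [ N ]
  ≡₂-lower {x} {k} {z} {N} {M} le h = subst (2^ (N ℕ.+ k) ∣ℤ_)
    (solve 3 (λ a b c → (a :- c) :- (a :- b) := b :- c) ≡.refl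
      (res x M) (res x (N ℕ.+ k)) (2^ k ℤ.* z))
    (∣m∣n⇒∣m-n h (coherent-≤ x le))

  private
    l+[N+k] : ∀ N k l → l ℕ.+ (N ℕ.+ k) ≡ N ℕ.+ (k ℕ.+ l)
    l+[N+k] N k l = ≡.trans (ℕ.+-comm l (N ℕ.+ k)) (ℕ.+-assoc N k l)

    k+[N+l] : ∀ N k l → k ℕ.+ (N ℕ.+ l) ≡ N ℕ.+ (k ℕ.+ l)
    k+[N+l] N k l = ≡.trans (l+[N+k] N l k) (cong (N ℕ.+_) (ℕ.+-comm l k))

    N+k≤ : ∀ N k l → N ℕ.+ k ℕ.≤ N ℕ.+ (k ℕ.+ l)
    N+k≤ N k l = ℕ.+-monoʳ-≤ N (ℕ.m≤m+n k l)

    N+l≤ : ∀ N k l → N ℕ.+ l ℕ.≤ N ℕ.+ (k ℕ.+ l)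
    N+l≤ N k l = ℕ.+-monoʳ-≤ N (ℕ.m≤n+m l k)

  module Q₂ = RawRing ℚ₂-rawRing

  ≈-sym : ∀ u v → u Q₂.≈ v → v Q₂.≈ u
  ≈-sym (x /2^ k) (y /2^ l) e n = subst (2^ n ∣ℤ_)
    (solve 2 (λ a b → :- (a :- b) := b :- a) ≡.refl (2^ l ℤ.* res x n) (2^ k ℤ.* res y n))
    (∣m⇒∣-m (e n))

  -- Equality in ℚ₂ is cross-multiplied, so it first yields the congruence for `v` multiplied by 2ᵏ.
  -- Working at index N + k + l leaves room to cancel that factor.
  ≡₂-cong : ∀ u v {z N} → u Q₂.≈ v → u ≡₂ z [ N ] → v ≡₂ z [ N ]
  ≡₂-cong (x /2^ k) (y /2^ l) {z} {N} e h =
    ≡₂-lower {y} {l} {z} {N} {M} (N+l≤ N k l)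
      (2^-cancel-∣ k (N ℕ.+ l)
        (2^-resp-∣ (≡.sym (k+[N+l] N k l))
          (subst (2^ M ∣ℤ_)
            (solve 5 (λ X Y p q z → q :* (X :- p :* z) :- (q :* X :- p :* Y) := p :* (Y :- q :* z))
               ≡.refl X Y (2^ k) (2^ l) z)
            (∣m∣n⇒∣m-n
              (2^-resp-∣ (l+[N+k] N k l)
                (2^-*-∣ l (N ℕ.+ k) (≡₂-raise {x} {k} {z} {N} (N+k≤ N k l) h)))
              (e M)))))
    where
    M = N ℕ.+ (k ℕ.+ l)
    X = res x M
    Y = res y M

  ≡₂-+ : ∀ u v {z w N} → u ≡₂ z [ N ] → v ≡₂ w [ N ] → u Q₂.+ v ≡₂ z ℤ.+ w [ N ]
  ≡₂-+ (x /2^ k) (y /2^ l) {z} {w} {N} h h′ = subst (2^ M ∣ℤ_)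
    (≡.trans
      (solve 6 (λ X Y p q z w → q :* (X :- p :* z) :+ p :* (Y :- q :* w)
          := q :* X :+ p :* Y :- p :* q :* (z :+ w)) ≡.refl X Y (2^ k) (2^ l) z w)
      (cong (λ t → 2^ l ℤ.* X ℤ.+ 2^ k ℤ.* Y ℤ.- t ℤ.* (z ℤ.+ w)) (≡.sym (2^-+ k l))))
    (∣m∣n⇒∣m+n
      (2^-resp-∣ (l+[N+k] N k l)
        (2^-*-∣ l (N ℕ.+ k) (≡₂-raise {x} {k} {z} {N} (N+k≤ N k l) h)))
      (2^-resp-∣ (k+[N+l] N k l)
        (2^-*-∣ k (N ℕ.+ l) (≡₂-raise {y} {l} {w} {N} (N+l≤ N k l) h′))))
    where
    M = N ℕ.+ (k ℕ.+ l)
    X = res x M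
    Y = res y M

  ≡₂-neg : ∀ u {z N} → u ≡₂ z [ N ] → Q₂.- u ≡₂ ℤ.- z [ N ]
  ≡₂-neg (x /2^ k) {z} {N} h = subst (2^ (N ℕ.+ k) ∣ℤ_)
    (solve 3 (λ X p z → :- (X :- p :* z) := :- X :- p :* (:- z)) ≡.refl
      (res x (N ℕ.+ k)) (2^ k) z)
    (∣m⇒∣-m h)

  ≡₂-* : ∀ u v {z w N} → u ≡₂ z [ N ] → v ≡₂ w [ N ] → u Q₂.* v ≡₂ z ℤ.* w [ N ]
  ≡₂-* (x /2^ k) (y /2^ l) {z} {w} {N} h h′ = subst (2^ M ∣ℤ_)
    (≡.trans
      (solve 6 (λ X Y p q z w → (X :- p :* z) :* Y :+ p :* ((Y :- q :* w) :* z)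
          := X :* Y :- p :* q :* (z :* w)) ≡.refl X Y (2^ k) (2^ l) z w)
      (cong (λ t → X ℤ.* Y ℤ.- t ℤ.* (z ℤ.* w)) (≡.sym (2^-+ k l))))
    (∣m∣n⇒∣m+n
      (subst (_∣ℤ (X ℤ.- 2^ k ℤ.* z) ℤ.* Y)
        (≡.trans (≡.sym (2^-+ (N ℕ.+ k) l)) (cong 2^_ (ℕ.+-assoc N k l)))
        (*-pres-∣ hX l∣Y))
      (2^-resp-∣ (k+[N+l] N k l)
        (2^-*-∣ k (N ℕ.+ l) (∣m⇒∣m*n z hY))))
    where
    M = N ℕ.+ (k ℕ.+ l)
    X = res x M
    Y = res y M
    hX = ≡₂-raise {x} {k} {z} {N} (N+k≤ N k l) h
    hY = ≡₂-raise {y} {l} {w} {N} (N+l≤ N k l) h′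
    -- A fraction congruent to an integer is itself integral, so its numerator is divisible by its
    -- denominator. This supplies the power 2ˡ missing from the first summand.
    l∣Y : 2^ l ∣ℤ Y
    l∣Y = subst (2^ l ∣ℤ_) (solve 2 (λ Y t → (Y :- t) :+ t := Y) ≡.refl Y (2^ l ℤ.* w))
      (∣m∣n⇒∣m+n (Div.∣-trans (2^-mono-∣ (ℕ.m≤n+m l N)) hY) (∣m⇒∣m*n w Div.∣-refl))

  ≡₂-1 : ∀ N → Q₂.1# ≡₂ 1ℤ [ N ]
  ≡₂-1 N = divides 0ℤ ≡.refl

  ≡₂-0 : ∀ N → Q₂.0# ≡₂ 0ℤ [ N ]
  ≡₂-0 N = divides 0ℤ ≡.refl

  ≡₂-shift : ∀ u {z w N} → 2^ N ∣ℤ z ℤ.- w → u ≡₂ z [ N ] → u ≡₂ w [ N ]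
  ≡₂-shift (x /2^ k) {z} {w} {N} d h = subst (2^ (N ℕ.+ k) ∣ℤ_)
    (solve 4 (λ X p z w → (X :- p :* z) :+ p :* (z :- w) := X :- p :* w) ≡.refl
      (res x (N ℕ.+ k)) (2^ k) z w)
    (∣m∣n⇒∣m+n h (2^-resp-∣ (ℕ.+-comm k N) (2^-*-∣ k N d)))

  ≡₂-unique : ∀ u {z w N} → u ≡₂ z [ N ] → u ≡₂ w [ N ] → 2^ N ∣ℤ z ℤ.- w
  ≡₂-unique (x /2^ k) {z} {w} {N} h h′ = 2^-cancel-∣ k N
    (2^-resp-∣ (ℕ.+-comm N k)
      (subst (2^ (N ℕ.+ k) ∣ℤ_)
        (solve 4 (λ X p z w → (X :- p :* w) :- (X :- p :* z) := p :* (z :- w)) ≡.refl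
          (res x (N ℕ.+ k)) (2^ k) z w)
        (∣m∣n⇒∣m-n h′ h)))

  ≡₂-weaken : ∀ u {z N M} → N ℕ.≤ M → u ≡₂ z [ M ] → u ≡₂ z [ N ]
  ≡₂-weaken (x /2^ k) {z} {N} {M} le h =
    ≡₂-lower {x} {k} {z} {N} {M ℕ.+ k} (ℕ.+-monoˡ-≤ k le)
      (Div.∣-trans (2^-mono-∣ (ℕ.+-monoˡ-≤ k le)) h)

  -- Congruence to some integer, even modulo 2⁰, already places the fraction in ℤ₂: the numerator is
  -- divisible by 2ᵏ at index M + k, and the quotient there is the finer residue.
  ≡₂-refine : ∀ u {z N} M → u ≡₂ z [ N ] → ∃ λ w → u ≡₂ w [ M ]
  ≡₂-refine (x /2^ k) {z} {N} M h
    = quotient k∣X , divides 0ℤ (≡.trans (cong (ℤ._- 2^ k ℤ.* quotient k∣X) (equality k∣X))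
        (solve 2 (λ q p → q :* p :- p :* q := con 0ℤ) ≡.refl (quotient k∣X) (2^ k)))
    where
    open Div._∣_
    X = res x (M ℕ.+ k)
    k∣X : 2^ k ∣ℤ X
    k∣X = subst (2^ k ∣ℤ_)
      (solve 4 (λ a b c t → ((b :- t) :- (c :- a)) :+ (t :+ (c :- b)) := a) ≡.refl
        X (res x (N ℕ.+ k)) (res x (M ℕ.+ k ℕ.+ (N ℕ.+ k))) (2^ k ℤ.* z))
      (∣m∣n⇒∣m+n
        (∣m∣n⇒∣m-n (Div.∣-trans (2^-mono-∣ (ℕ.m≤n+m k N)) h)
          (Div.∣-trans (2^-mono-∣ (ℕ.m≤n+m k M)) (coherent-≤ x (ℕ.m≤m+n (M ℕ.+ k) (N ℕ.+ k)))))
        (∣m∣n⇒∣m+n (∣m⇒∣m*n z Div.∣-refl)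
          (Div.∣-trans (2^-mono-∣ (ℕ.m≤n+m k N)) (coherent-≤ x (ℕ.m≤n+m (N ℕ.+ k) (M ℕ.+ k))))))

  -- Here `v` is the integer `c` written as an arbitrary fraction. The image of 2ᵏ under an
  -- embedding is known up to equality in ℚ₂, with an unspecified exponent `l`, so its products must
  -- be compared through residues.
  module _ (v : ℚ₂) {c : ℤ} (v≡c : ∀ M → v ≡₂ c [ M ]) (x : ℤ₂) (k : ℕ) {z : ℤ} {N : ℕ} where
    private
      l = ℚ₂.exp v
      M = N ℕ.+ (l ℕ.+ k)
      X = res x M
      Y = res (ℚ₂.num v) M
      hY : 2^ M ∣ℤ (Y ℤ.- 2^ l ℤ.* c) ℤ.* X
      hY = ∣m⇒∣m*n X (2^-resp-∣ eq
        (≡₂-raise {ℚ₂.num v} {l} {c} {N ℕ.+ k} (ℕ.≤-reflexive eq) (v≡c (N ℕ.+ k))))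
        where
        eq : N ℕ.+ k ℕ.+ l ≡ M
        eq = ≡.trans (ℕ.+-assoc N k l) (cong (N ℕ.+_) (ℕ.+-comm k l))
      expand : Y ℤ.* X ℤ.- 2^ (l ℕ.+ k) ℤ.* z
        ≡ (Y ℤ.- 2^ l ℤ.* c) ℤ.* X ℤ.+ 2^ l ℤ.* (c ℤ.* X ℤ.- 2^ k ℤ.* z)
      expand = ≡.trans (cong (λ t → Y ℤ.* X ℤ.- t ℤ.* z) (2^-+ l k))
        (solve 6 (λ X Y p q c z → Y :* X :- q :* p :* z
          := (Y :- q :* c) :* X :+ q :* (c :* X :- p :* z)) ≡.refl X Y (2^ k) (2^ l) c z)
      coh : 2^ (N ℕ.+ k) ∣ℤ c ℤ.* (X ℤ.- res x (N ℕ.+ k))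
      coh = ∣n⇒∣m*n c (coherent-≤ x (N+l≤ N l k))

    scale-numerator : 2^ (N ℕ.+ k) ∣ℤ c ℤ.* res x (N ℕ.+ k) ℤ.- 2^ k ℤ.* z →
      v Q₂.* (x /2^ k) ≡₂ z [ N ]
    scale-numerator h = subst (2^ M ∣ℤ_) (≡.sym expand)
      (∣m∣n⇒∣m+n hY (2^-resp-∣ (k+[N+l] N l k) (2^-*-∣ l (N ℕ.+ k)
        (subst (2^ (N ℕ.+ k) ∣ℤ_)
          (solve 4 (λ c X x t → c :* (X :- x) :+ (c :* x :- t) := c :* X :- t) ≡.refl
            c X (res x (N ℕ.+ k)) (2^ k ℤ.* z))
          (∣m∣n⇒∣m+n coh h)))))

    unscale-numerator : v Q₂.* (x /2^ k) ≡₂ z [ N ] →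
      2^ (N ℕ.+ k) ∣ℤ c ℤ.* res x (N ℕ.+ k) ℤ.- 2^ k ℤ.* z
    unscale-numerator h = subst (2^ (N ℕ.+ k) ∣ℤ_)
      (solve 4 (λ c X x t → (c :* X :- t) :- c :* (X :- x) := c :* x :- t) ≡.refl
        c X (res x (N ℕ.+ k)) (2^ k ℤ.* z))
      (∣m∣n⇒∣m-n (2^-cancel-∣ l (N ℕ.+ k)
        (2^-resp-∣ (≡.sym (k+[N+l] N l k))
          (Div.∣m+n∣m⇒∣n (subst (2^ M ∣ℤ_) expand h) hY))) coh)

  module _ (v : ℚ₂) (k : ℕ) (v≡2ᵏ : ∀ M → v ≡₂ 2^ k [ M ]) where

    clear-denominator : ∀ x N → v Q₂.* (x /2^ k) ≡₂ res x (N ℕ.+ k) [ N ]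
    clear-denominator x N = scale-numerator v v≡2ᵏ x k
      (divides 0ℤ (ℤ.+-inverseʳ (2^ k ℤ.* res x (N ℕ.+ k))))

    2^-multiple : ∀ u {z N} → u ≡₂ z [ N ] → v Q₂.* u ≡₂ 2^ k ℤ.* z [ k ℕ.+ N ]
    2^-multiple (x /2^ l) {z} {N} h = scale-numerator v v≡2ᵏ x l
      (subst₂ _∣ℤ_ (cong 2^_ (≡.sym (ℕ.+-assoc k N l)))
        (solve 4 (λ p x q z → p :* (x :- q :* z) := p :* x :- q :* (p :* z)) ≡.refl
          (2^ k) (res x (k ℕ.+ N ℕ.+ l)) (2^ l) z)
        (2^-*-∣ k (N ℕ.+ l) (≡₂-raise {x} {l} {z} {N}
          (subst (N ℕ.+ l ℕ.≤_) (≡.sym (ℕ.+-assoc k N l)) (ℕ.m≤n+m _ k)) h)))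

    2^-cancel : ∀ u {z N} → v Q₂.* u ≡₂ 2^ k ℤ.* z [ k ℕ.+ N ] → u ≡₂ z [ N ]
    2^-cancel (x /2^ l) {z} {N} h = ≡₂-lower {x} {l} {z} {N}
      (subst (N ℕ.+ l ℕ.≤_) (≡.sym (ℕ.+-assoc k N l)) (ℕ.m≤n+m _ k))
      (2^-cancel-∣ k (N ℕ.+ l)
        (subst₂ _∣ℤ_ (cong 2^_ (ℕ.+-assoc k N l))
          (solve 4 (λ p x q z → p :* x :- q :* (p :* z) := p :* (x :- q :* z)) ≡.refl
            (2^ k) (res x (k ℕ.+ N ℕ.+ l)) (2^ l) z)
          (unscale-numerator v v≡2ᵏ x l h)))

  -- Binary digits and remainders.

  ∣-∸⇒≤ : ∀ {m n} d → n ℕ.< d → d ℕ.∣ n ℕ.∸ m → n ℕ.≤ m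
  ∣-∸⇒≤ {m} {n} d n<d h with n ℕ.∸ m in eq
  ... | zero  = ℕ.m∸n≡0⇒m≤n eq
  ... | suc e = contradiction (ℕ.∣⇒≤ h)
    (ℕ.<⇒≱ (ℕ.≤-<-trans (subst (ℕ._≤ n) eq (ℕ.m∸n≤m n m)) n<d))

  residue-unique : ∀ {m n} d → m ℕ.< d → n ℕ.< d → + d ∣ℤ + m ℤ.- + n → m ≡ n
  residue-unique {m} {n} d m<d n<d h with ℕ.≤-total m n
  ... | inj₁ m≤n = ℕ.≤-antisym m≤n (∣-∸⇒≤ d n<d
    (subst (d ℕ.∣_) (≡.trans (cong ℤ.∣_∣ (ℤ.m-n≡m⊖n m n)) (ℤ.∣⊖∣-≤ m≤n)) (Div.∣⇒∣ᵤ h)))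
  ... | inj₂ n≤m = ℕ.≤-antisym (∣-∸⇒≤ d m<d
    (subst (d ℕ.∣_) (≡.trans (cong ℤ.∣_∣ (ℤ.m-n≡m⊖n m n))
       (≡.trans (ℤ.∣m⊖n∣≡∣n⊖m∣ m n) (ℤ.∣⊖∣-≤ n≤m))) (Div.∣⇒∣ᵤ h))) n≤m

  ∣-%ℕ : ∀ i d .{{_ : ℕ.NonZero d}} → + d ∣ℤ i ℤ.- + (i ℤ.%ℕ d)
  ∣-%ℕ i d = divides (i ℤ./ℕ d) (≡.trans (cong (ℤ._- + (i ℤ.%ℕ d)) (ℤ.a≡a%ℕn+[a/ℕn]*n i d))
    (solve 2 (λ r q → r :+ q :- r := q) ≡.refl (+ (i ℤ.%ℕ d)) (i ℤ./ℕ d ℤ.* + d)))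

  ∣-% : ∀ m d .{{_ : ℕ.NonZero d}} → + d ∣ℤ + m ℤ.- + (m ℕ.% d)
  ∣-% m d = ∣-%ℕ (+ m) d

  -- The top digit is the quotient by 2ʲ of the remainder modulo 2ʲ⁺¹. By coherence, reducing that
  -- remainder modulo 2ʲ gives the remainder one level below, so the recursion is Euclidean
  -- division.
  digitSum-remainder : ∀ x j → digitSum x j ≡ ℤ._%ℕ_ (res x j) (2 ℕ.^ j) {{ℕ.m^n≢0 2 j}}
  digitSum-remainder x zero    = residue-unique 1 (ℕ.s≤s ℕ.z≤n) (ℤ.n%ℕd<d (res x 0) 1)
    (divides (0ℤ ℤ.- + (res x 0 ℤ.%ℕ 1)) (≡.sym (ℤ.*-identityʳ _)))
  digitSum-remainder x (suc j) = begin
    digitSum x j ℕ.+ digit x j ℕ.* 2 ℕ.^ j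
      ≡⟨ cong (ℕ._+ digit x j ℕ.* 2 ℕ.^ j) (digitSum-remainder x j) ⟩
    (res x j ℤ.%ℕ d) ℕ.+ r ℕ./ d ℕ.* d
      ≡⟨ cong (ℕ._+ r ℕ./ d ℕ.* d) (residue-unique d (ℤ.n%ℕd<d (res x j) d) (ℕ.m%n<n r d) same) ⟩
    r ℕ.% d ℕ.+ r ℕ./ d ℕ.* d
      ≡⟨ ℕ.m≡m%n+[m/n]*n r d ⟨
    r ∎
    where
    open ≡.≡-Reasoning
    instance
      d≢0 = ℕ.m^n≢0 2 j
      D≢0 = ℕ.m^n≢0 2 (suc j)
    d = 2 ℕ.^ j
    r = res x (suc j) ℤ.%ℕ (2 ℕ.^ suc j)
    same : + d ∣ℤ + (res x j ℤ.%ℕ d) ℤ.- + (r ℕ.% d)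
    same = subst (+ d ∣ℤ_)
      (solve 5 (λ a b c e f → ((e :- f) :+ (c :- e)) :- ((c :- b) :+ (b :- a)) := a :- f) ≡.refl
        (+ (res x j ℤ.%ℕ d)) (res x j) (res x (suc j)) (+ r) (+ (r ℕ.% d)))
      (∣m∣n⇒∣m-n
        (∣m∣n⇒∣m+n (∣-% r d)
          (Div.∣-trans (2^-mono-∣ (ℕ.n≤1+n j)) (∣-%ℕ (res x (suc j)) (2 ℕ.^ suc j))))
        (∣m∣n⇒∣m+n (coherent x j) (∣-%ℕ (res x j) d)))

  digitSum-∣ : ∀ x j → 2^ j ∣ℤ res x j ℤ.- + digitSum x j
  digitSum-∣ x j = subst (λ t → 2^ j ∣ℤ res x j ℤ.- + t) (≡.sym (digitSum-remainder x j))
    (∣-%ℕ (res x j) (2 ℕ.^ j) {{ℕ.m^n≢0 2 j}})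

open 2-Adic

-- Rational bounds for real numbers

ℚ-ring : AlmostCommutativeRing 0ℓ 0ℓ
ℚ-ring = fromCommutativeRing ℚ.+-*-commutativeRing λ q → dec⇒maybe (0ℚ ℚ.≟ q)

<⇒≱ : ∀ {p q} → p ℚ.< q → ¬ q ℚ.≤ p
<⇒≱ p<q q≤p = ℚ.<-irrefl ≡.refl (ℚ.<-≤-trans p<q q≤p)

≤⇒0≤- : ∀ {p q} → p ℚ.≤ q → 0ℚ ℚ.≤ q ℚ.- p
≤⇒0≤- {p} {q} p≤q = subst (ℚ._≤ q ℚ.- p) (ℚ.+-inverseʳ p) (ℚ.+-monoˡ-≤ (ℚ.- p) p≤q)

0≤-⇒≤ : ∀ {p q} → 0ℚ ℚ.≤ q ℚ.- p → p ℚ.≤ q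
0≤-⇒≤ {p} {q} h = subst₂ ℚ._≤_ (ℚ.+-identityˡ p) (cancel q p) (ℚ.+-monoˡ-≤ p h)
  where
  cancel : ∀ q p → q ℚ.- p ℚ.+ p ≡ q
  cancel = solve-∀ ℚ-ring

≤-by₁ : ∀ {p q a b} → q ℚ.- p ≡ b ℚ.- a → a ℚ.≤ b → p ℚ.≤ q
≤-by₁ e h = 0≤-⇒≤ (subst (0ℚ ℚ.≤_) (≡.sym e) (≤⇒0≤- h))

≤-by₂ : ∀ {p q a b c d} → q ℚ.- p ≡ (b ℚ.- a) ℚ.+ (d ℚ.- c) → a ℚ.≤ b → c ℚ.≤ d → p ℚ.≤ q
≤-by₂ e h k = 0≤-⇒≤ (subst (0ℚ ℚ.≤_) (≡.sym e) (ℚ.+-mono-≤ (≤⇒0≤- h) (≤⇒0≤- k)))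

<⇒0<- : ∀ {p q} → p ℚ.< q → 0ℚ ℚ.< q ℚ.- p
<⇒0<- {p} {q} p<q = subst (ℚ._< q ℚ.- p) (ℚ.+-inverseʳ p) (ℚ.+-monoˡ-< (ℚ.- p) p<q)

0<½* : ∀ {ε} → 0ℚ ℚ.< ε → 0ℚ ℚ.< ½ ℚ.* ε
0<½* {ε} 0<ε = subst (ℚ._< ½ ℚ.* ε) (ℚ.*-zeroʳ ½) (ℚ.*-monoʳ-<-pos ½ 0<ε)

½*+½* : ∀ ε → ½ ℚ.* ε ℚ.+ ½ ℚ.* ε ≡ ε
½*+½* ε = ≡.trans (≡.sym (ℚ.*-distribʳ-+ ε ½ ½)) (ℚ.*-identityˡ ε)

∣∣-lub : ∀ {p q} → p ℚ.≤ q → ℚ.- p ℚ.≤ q → ∣ p ∣ ℚ.≤ q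
∣∣-lub {p} h k with ℚ.∣p∣≡p∨∣p∣≡-p p
... | inj₁ e = subst (ℚ._≤ _) (≡.sym e) h
... | inj₂ e = subst (ℚ._≤ _) (≡.sym e) k

p≤∣p∣ : ∀ p → p ℚ.≤ ∣ p ∣
p≤∣p∣ p with ℚ.∣p∣≡p∨∣p∣≡-p p | ℚ.≤-total 0ℚ p
... | inj₁ e | _        = ℚ.≤-reflexive (≡.sym e)
... | inj₂ e | inj₁ 0≤p = ℚ.≤-reflexive (≡.sym (ℚ.0≤p⇒∣p∣≡p 0≤p))
... | inj₂ e | inj₂ p≤0 = ℚ.≤-trans p≤0 (ℚ.0≤∣p∣ p)

-p≤∣p∣ : ∀ p → ℚ.- p ℚ.≤ ∣ p ∣
-p≤∣p∣ p = subst (ℚ.- p ℚ.≤_) (ℚ.∣-p∣≡∣p∣ p) (p≤∣p∣ (ℚ.- p))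

*-mono-≤-nonNeg : ∀ {a b c d} → 0ℚ ℚ.≤ c → 0ℚ ℚ.≤ b → a ℚ.≤ b → c ℚ.≤ d → a ℚ.* c ℚ.≤ b ℚ.* d
*-mono-≤-nonNeg {a} {b} {c} {d} 0≤c 0≤b a≤b c≤d = ℚ.≤-trans
  (ℚ.*-monoʳ-≤-nonNeg c {{ℚ.nonNegative 0≤c}} a≤b)
  (ℚ.*-monoˡ-≤-nonNeg b {{ℚ.nonNegative 0≤b}} c≤d)

0≤* : ∀ {p q} → 0ℚ ℚ.≤ p → 0ℚ ℚ.≤ q → 0ℚ ℚ.≤ p ℚ.* q
0≤* 0≤p 0≤q = *-mono-≤-nonNeg ℚ.≤-refl 0≤p 0≤p 0≤q

≤-by-ε : ∀ {p q} → (∀ ε → 0ℚ ℚ.< ε → p ℚ.≤ q ℚ.+ ε) → p ℚ.≤ q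
≤-by-ε {p} {q} h with p ℚ.≤? q
... | yes p≤q = p≤q
... | no  p≰q with m , q<m , m<p ← ℚ.<-dense (ℚ.≰⇒> p≰q) =
  contradiction (subst (p ℚ.≤_) (back q m) (h (m ℚ.- q) (<⇒0<- q<m))) (<⇒≱ m<p)
  where
  back : ∀ q m → q ℚ.+ (m ℚ.- q) ≡ m
  back = solve-∀ ℚ-ring

Eventually : (ℕ → Set) → Set
Eventually P = ∃ λ N → ∀ n → N ℕ.≤ n → P n

eventually₂ : ∀ {P Q R : ℕ → Set} → (∀ n → P n → Q n → R n) →
  Eventually P → Eventually Q → Eventually R
eventually₂ f (M , p) (N , q) = M ℕ.⊔ N , λ n le →
  f n (p n (ℕ.m⊔n≤o⇒m≤o M N le)) (q n (ℕ.m⊔n≤o⇒n≤o M N le))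

eventually₁ : ∀ {P Q : ℕ → Set} → (∀ n → P n → Q n) → Eventually P → Eventually Q
eventually₁ f (M , p) = M , λ n le → f n (p n le)

-- |x| ≤ r for the real number represented by x.  Bounding bare sequences keeps
-- the proofs of the Cauchy property out of the types.
record AbsBound (x : ℕ → ℚ) (r : ℚ) : Set where
  constructor absBound
  field
    eventually-≤ : ∀ ε → 0ℚ ℚ.< ε → Eventually λ n → ∣ x n ∣ ℚ.≤ r ℚ.+ ε

open AbsBound

AbsBound-ext : ∀ (x y : ℕ → ℚ) {r} → (∀ n → x n ≡ y n) → AbsBound x r → AbsBound y r
AbsBound-ext x y {r} e h .eventually-≤ ε 0<ε =
  eventually₁ (λ n → subst (λ t → ∣ t ∣ ℚ.≤ r ℚ.+ ε) (e n)) (eventually-≤ h ε 0<ε)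

private
  halves : ∀ r s ε → (r ℚ.+ ½ ℚ.* ε) ℚ.+ (s ℚ.+ ½ ℚ.* ε) ≡ (r ℚ.+ s) ℚ.+ ε
  halves r s ε = ≡.trans (regroup r s (½ ℚ.* ε)) (cong (r ℚ.+ s ℚ.+_) (½*+½* ε))
    where
    regroup : ∀ r s h → (r ℚ.+ h) ℚ.+ (s ℚ.+ h) ≡ (r ℚ.+ s) ℚ.+ (h ℚ.+ h)
    regroup = solve-∀ ℚ-ring

AbsBound-+ : ∀ (x y : ℕ → ℚ) {r s} → AbsBound x r → AbsBound y s → AbsBound (λ n → x n ℚ.+ y n) (r ℚ.+ s)
AbsBound-+ x y {r} {s} hx hy .eventually-≤ ε 0<ε = eventually₂
  (λ n a b → ℚ.≤-trans (ℚ.∣p+q∣≤∣p∣+∣q∣ (x n) (y n))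
    (subst (_ ℚ.≤_) (halves r s ε) (ℚ.+-mono-≤ a b)))
  (eventually-≤ hx (½ ℚ.* ε) (0<½* 0<ε)) (eventually-≤ hy (½ ℚ.* ε) (0<½* 0<ε))

AbsBound-neg : ∀ (x : ℕ → ℚ) {r} → AbsBound x r → AbsBound (λ n → ℚ.- x n) r
AbsBound-neg x {r} h .eventually-≤ ε 0<ε =
  eventually₁ (λ n → subst (ℚ._≤ r ℚ.+ ε) (≡.sym (ℚ.∣-p∣≡∣p∣ (x n))))
    (eventually-≤ h ε 0<ε)

AbsBound-mono : ∀ (x : ℕ → ℚ) {r s} → r ℚ.≤ s → AbsBound x r → AbsBound x s
AbsBound-mono x r≤s h .eventually-≤ ε 0<ε =
  eventually₁ (λ n a → ℚ.≤-trans a (ℚ.+-monoˡ-≤ ε r≤s)) (eventually-≤ h ε 0<ε)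

AbsBound-* : ∀ (x y : ℕ → ℚ) {r s} → 0ℚ ℚ.≤ r → 0ℚ ℚ.≤ s →
  AbsBound x r → AbsBound y s → AbsBound (λ n → x n ℚ.* y n) (r ℚ.* s)
AbsBound-* x y {r} {s} 0≤r 0≤s hx hy .eventually-≤ ε 0<ε =
  eventually₂ step (eventually-≤ hx δ 0<δ) (eventually-≤ hy δ 0<δ)
  where
  -- With δ = ε / D, the excess δ (r + s + δ) is at most δ D = ε once δ ≤ 1 + ε, which follows from
  -- ε ≤ D ≤ (1 + ε) D.
  D = r ℚ.+ s ℚ.+ (1ℚ ℚ.+ ε)
  0<D : 0ℚ ℚ.< D
  0<D = ℚ.+-mono-≤-< (ℚ.+-mono-≤ 0≤r 0≤s) (ℚ.+-mono-<-≤ (ℚ.positive⁻¹ 1ℚ) (ℚ.<⇒≤ 0<ε))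
  instance
    D-pos : ℚ.Positive D
    D-pos = ℚ.positive 0<D
    D≢0 : NonZero D
    D≢0 = ℚ.pos⇒nonZero D
  δ = ε ℚ.* ℚ.1/ D
  0<δ : 0ℚ ℚ.< δ
  0<δ = subst (ℚ._< δ) (ℚ.*-zeroˡ (ℚ.1/ D))
    (ℚ.*-monoˡ-<-pos (ℚ.1/ D) {{ℚ.1/pos⇒pos D}} 0<ε)
  δD≡ε : δ ℚ.* D ≡ ε
  δD≡ε = ≡.trans (ℚ.*-assoc ε (ℚ.1/ D) D) (≡.trans (cong (ε ℚ.*_) (ℚ.*-inverseˡ D)) (ℚ.*-identityʳ ε))
  δ≤1+ε : δ ℚ.≤ 1ℚ ℚ.+ ε
  δ≤1+ε = ℚ.*-cancelʳ-≤-pos {δ} {1ℚ ℚ.+ ε} D (subst (ℚ._≤ (1ℚ ℚ.+ ε) ℚ.* D) (≡.sym δD≡ε) (begin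
    ε                     ≡⟨ ℚ.+-identityˡ ε ⟨
    0ℚ ℚ.+ ε              ≤⟨ ℚ.+-mono-≤ (ℚ.+-mono-≤ 0≤r 0≤s) (≤-by₁ (idε ε) (ℚ.<⇒≤ (ℚ.positive⁻¹ 1ℚ))) ⟩
    D                     ≡⟨ ℚ.*-identityˡ D ⟨
    1ℚ ℚ.* D              ≤⟨ ℚ.*-monoʳ-≤-nonNeg D {{ℚ.pos⇒nonNeg D}}
                               (≤-by₁ {1ℚ} {1ℚ ℚ.+ ε} (idε′ ε) (ℚ.<⇒≤ 0<ε)) ⟩
    (1ℚ ℚ.+ ε) ℚ.* D      ∎))
    where
    open ℚ.≤-Reasoning
    idε : ∀ ε → (1ℚ ℚ.+ ε) ℚ.- ε ≡ 1ℚ ℚ.- 0ℚ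
    idε = solve-∀ ℚ-ring
    idε′ : ∀ ε → (1ℚ ℚ.+ ε) ℚ.- 1ℚ ≡ ε ℚ.- 0ℚ
    idε′ = solve-∀ ℚ-ring
  step : ∀ n → ∣ x n ∣ ℚ.≤ r ℚ.+ δ → ∣ y n ∣ ℚ.≤ s ℚ.+ δ →
    ∣ x n ℚ.* y n ∣ ℚ.≤ r ℚ.* s ℚ.+ ε
  step n a b = begin
    ∣ x n ℚ.* y n ∣        ≡⟨ ℚ.∣p*q∣≡∣p∣*∣q∣ (x n) (y n) ⟩
    ∣ x n ∣ ℚ.* ∣ y n ∣    ≤⟨ *-mono-≤-nonNeg (ℚ.0≤∣p∣ (y n))
                                      (ℚ.+-mono-≤ 0≤r (ℚ.<⇒≤ 0<δ)) a b ⟩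
    (r ℚ.+ δ) ℚ.* (s ℚ.+ δ)        ≡⟨ expand r s δ ⟩
    r ℚ.* s ℚ.+ δ ℚ.* (r ℚ.+ s ℚ.+ δ)
      ≤⟨ ℚ.+-monoʳ-≤ (r ℚ.* s) (ℚ.*-monoˡ-≤-nonNeg δ {{ℚ.nonNegative (ℚ.<⇒≤ 0<δ)}}
           (ℚ.+-monoʳ-≤ (r ℚ.+ s) δ≤1+ε)) ⟩
    r ℚ.* s ℚ.+ δ ℚ.* D            ≡⟨ cong (r ℚ.* s ℚ.+_) δD≡ε ⟩
    r ℚ.* s ℚ.+ ε                  ∎
    where
    open ℚ.≤-Reasoning
    expand : ∀ r s δ → (r ℚ.+ δ) ℚ.* (s ℚ.+ δ) ≡ r ℚ.* s ℚ.+ δ ℚ.* (r ℚ.+ s ℚ.+ δ)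
    expand = solve-∀ ℚ-ring

AbsBound-fromℚ : ∀ r → AbsBound (λ _ → r) ∣ r ∣
AbsBound-fromℚ r .eventually-≤ ε 0<ε = 0 , λ _ _ →
  ≤-by₁ (cancel ∣ r ∣ ε) (ℚ.<⇒≤ 0<ε)
  where
  cancel : ∀ a ε → (a ℚ.+ ε) ℚ.- a ≡ ε ℚ.- 0ℚ
  cancel = solve-∀ ℚ-ring

AbsBound-fromℚ⁻¹ : ∀ {r s} → AbsBound (λ _ → r) s → ∣ r ∣ ℚ.≤ s
AbsBound-fromℚ⁻¹ h = ≤-by-ε λ ε 0<ε →
  proj₂ (eventually-≤ h ε 0<ε) (proj₁ (eventually-≤ h ε 0<ε)) ℕ.≤-refl

AbsBound-exists : ∀ x → ∃ λ T → 0ℚ ℚ.≤ T × AbsBound (seq x) T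
AbsBound-exists x =
  1ℚ ℚ.+ a , ℚ.+-mono-≤ (ℚ.<⇒≤ (ℚ.positive⁻¹ 1ℚ)) (ℚ.0≤∣p∣ (seq x N)) , absBound λ ε 0<ε →
    N , λ n le → begin
      ∣ seq x n ∣                            ≡⟨ cong ∣_∣ (split (seq x n) (seq x N)) ⟩
      ∣ (seq x n ℚ.- seq x N) ℚ.+ seq x N ∣  ≤⟨ ℚ.∣p+q∣≤∣p∣+∣q∣ (seq x n ℚ.- seq x N) (seq x N) ⟩
      ∣ seq x n ℚ.- seq x N ∣ ℚ.+ a          ≤⟨ ℚ.+-monoˡ-≤ a (ℚ.<⇒≤ (h n N le ℕ.≤-refl)) ⟩
      1ℚ ℚ.+ a                               ≤⟨ ≤-by₁ (cancel (1ℚ ℚ.+ a) ε) (ℚ.<⇒≤ 0<ε) ⟩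
      1ℚ ℚ.+ a ℚ.+ ε                         ∎
  where
  open ℚ.≤-Reasoning
  N = proj₁ (cauchy x 1ℚ (ℚ.positive⁻¹ 1ℚ))
  h = proj₂ (cauchy x 1ℚ (ℚ.positive⁻¹ 1ℚ))
  a = ∣ seq x N ∣
  split : ∀ p q → p ≡ (p ℚ.- q) ℚ.+ q
  split = solve-∀ ℚ-ring
  cancel : ∀ a ε → (a ℚ.+ ε) ℚ.- a ≡ ε ℚ.- 0ℚ
  cancel = solve-∀ ℚ-ring

-- An intermediate m splits the gap: m - r is spent as the slack of the bound, and s - m remains as
-- the uniform margin that a strict inequality in ℝ requires.
AbsBound⇒< : ∀ {x : ℕ → ℚ} {r s} → r ℚ.< s → AbsBound x r →
  ∃ λ δ → 0ℚ ℚ.< δ × Eventually λ n → ∣ x n ∣ ℚ.+ δ ℚ.≤ s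
AbsBound⇒< {x} {r} {s} r<s h with m , r<m , m<s ← ℚ.<-dense r<s =
  s ℚ.- m , <⇒0<- m<s ,
  eventually₁ (λ n a → ≤-by₁ (regroup ∣ x n ∣ r s m) a)
    (eventually-≤ h (m ℚ.- r) (<⇒0<- r<m))
  where
  regroup : ∀ a r s m → s ℚ.- (a ℚ.+ (s ℚ.- m)) ≡ (r ℚ.+ (m ℚ.- r)) ℚ.- a
  regroup = solve-∀ ℚ-ring

-- Sequences with null difference.

infix 4 _≐_

record _≐_ (x y : ℕ → ℚ) : Set where
  constructor null
  field
    difference : AbsBound (λ n → x n ℚ.- y n) 0ℚ

≈⇒≐ : ∀ x y → x ≈ᴿ y → seq x ≐ seq y
≈⇒≐ x y h = null (absBound λ ε 0<ε →
  eventually₁ (λ n a → subst (_ ℚ.≤_) (≡.sym (ℚ.+-identityˡ ε)) (ℚ.<⇒≤ a)) (h ε 0<ε))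

≐-ext : ∀ x y → (∀ n → x n ≡ y n) → x ≐ y
≐-ext x y e = null (AbsBound-ext (λ _ → 0ℚ) (λ n → x n ℚ.- y n)
  (λ n → ≡.sym (≡.trans (cong (ℚ._- y n) (e n)) (ℚ.+-inverseʳ (y n)))) (AbsBound-fromℚ 0ℚ))

AbsBound-resp : ∀ x y {r} → x ≐ y → AbsBound y r → AbsBound x r
AbsBound-resp x y {r} (null e) h = AbsBound-ext (λ n → (x n ℚ.- y n) ℚ.+ y n) x
  (λ n → back (x n) (y n))
  (AbsBound-mono _ (ℚ.≤-reflexive (ℚ.+-identityˡ r)) (AbsBound-+ (λ n → x n ℚ.- y n) y e h))
  where
  back : ∀ p q → (p ℚ.- q) ℚ.+ q ≡ p
  back = solve-∀ ℚ-ring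

≐-trans : ∀ x y z → x ≐ y → y ≐ z → x ≐ z
≐-trans x y z (null h) (null k) = null (AbsBound-ext (λ n → (x n ℚ.- y n) ℚ.+ (y n ℚ.- z n)) (λ n → x n ℚ.- z n)
  (λ n → telescope (x n) (y n) (z n))
  (AbsBound-+ (λ n → x n ℚ.- y n) (λ n → y n ℚ.- z n) h k))
  where
  telescope : ∀ p q r → (p ℚ.- q) ℚ.+ (q ℚ.- r) ≡ p ℚ.- r
  telescope = solve-∀ ℚ-ring

≐-sym : ∀ x y → x ≐ y → y ≐ x
≐-sym x y (null h) = null (AbsBound-ext (λ n → ℚ.- (x n ℚ.- y n)) (λ n → y n ℚ.- x n)
  (λ n → swap (x n) (y n)) (AbsBound-neg (λ n → x n ℚ.- y n) h))
  where
  swap : ∀ p q → ℚ.- (p ℚ.- q) ≡ q ℚ.- p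
  swap = solve-∀ ℚ-ring

≐-+ : ∀ x x′ y y′ → x ≐ x′ → y ≐ y′ → (λ n → x n ℚ.+ y n) ≐ (λ n → x′ n ℚ.+ y′ n)
≐-+ x x′ y y′ (null h) (null k) = null (AbsBound-ext
  (λ n → (x n ℚ.- x′ n) ℚ.+ (y n ℚ.- y′ n)) (λ n → (x n ℚ.+ y n) ℚ.- (x′ n ℚ.+ y′ n))
  (λ n → regroup (x n) (x′ n) (y n) (y′ n))
  (AbsBound-+ (λ n → x n ℚ.- x′ n) (λ n → y n ℚ.- y′ n) h k))
  where
  regroup : ∀ a b c d → (a ℚ.- b) ℚ.+ (c ℚ.- d) ≡ (a ℚ.+ c) ℚ.- (b ℚ.+ d)
  regroup = solve-∀ ℚ-ring

≐-neg : ∀ x y → x ≐ y → (λ n → ℚ.- x n) ≐ (λ n → ℚ.- y n)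
≐-neg x y (null h) = null (AbsBound-ext (λ n → ℚ.- (x n ℚ.- y n)) (λ n → (ℚ.- x n) ℚ.- (ℚ.- y n))
  (λ n → regroup (x n) (y n)) (AbsBound-neg (λ n → x n ℚ.- y n) h))
  where
  regroup : ∀ a b → ℚ.- (a ℚ.- b) ≡ (ℚ.- a) ℚ.- (ℚ.- b)
  regroup = solve-∀ ℚ-ring

≐-*ʳ : ∀ x y z {T} → 0ℚ ℚ.≤ T → AbsBound x T → y ≐ z → (λ n → y n ℚ.* x n) ≐ (λ n → z n ℚ.* x n)
≐-*ʳ x y z {T} 0≤T hx (null h) = null (AbsBound-ext
  (λ n → (y n ℚ.- z n) ℚ.* x n) (λ n → y n ℚ.* x n ℚ.- z n ℚ.* x n)
  (λ n → distrib (x n) (y n) (z n))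
  (AbsBound-mono _ (ℚ.≤-reflexive (ℚ.*-zeroˡ T))
    (AbsBound-* (λ n → y n ℚ.- z n) x ℚ.≤-refl 0≤T h hx)))
  where
  distrib : ∀ x y z → (y ℚ.- z) ℚ.* x ≡ y ℚ.* x ℚ.- z ℚ.* x
  distrib = solve-∀ ℚ-ring

≐-cancel : ∀ q .{{_ : NonZero q}} x r → (λ n → q ℚ.* x n) ≐ (λ _ → q ℚ.* r) → x ≐ (λ _ → r)
≐-cancel q x r (null h) = null (AbsBound-ext
  (λ n → ℚ.1/ q ℚ.* (q ℚ.* x n ℚ.- q ℚ.* r)) (λ n → x n ℚ.- r)
  (λ n → ≡.trans (regroup (ℚ.1/ q) q (x n) r)
    (≡.trans (cong (ℚ._* (x n ℚ.- r)) (ℚ.*-inverseˡ q)) (ℚ.*-identityˡ (x n ℚ.- r))))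
  (AbsBound-mono _ (ℚ.≤-reflexive (ℚ.*-zeroʳ ∣ ℚ.1/ q ∣))
    (AbsBound-* (λ _ → ℚ.1/ q) (λ n → q ℚ.* x n ℚ.- q ℚ.* r)
      (ℚ.0≤∣p∣ (ℚ.1/ q)) ℚ.≤-refl (AbsBound-fromℚ (ℚ.1/ q)) h)))
  where
  regroup : ∀ i q x r → i ℚ.* (q ℚ.* x ℚ.- q ℚ.* r) ≡ (i ℚ.* q) ℚ.* (x ℚ.- r)
  regroup = solve-∀ ℚ-ring

-- A negated order relation gives no index by itself; the Cauchy property does. If the term at N
-- exceeded r + 2η, the whole tail would exceed r + η, which is the excluded strict inequality.
-- Comparison of rationals is decidable, so the term at N is bounded, and the tail stays close to
-- it.
≯⇒AbsBound : ∀ x {r} → ¬ (fromℚ r <ᴿ x) → ¬ (fromℚ r <ᴿ -ᴿ x) → AbsBound (seq x) r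
≯⇒AbsBound x {r} h k .eventually-≤ ε 0<ε with cauchy x (½ ℚ.* (½ ℚ.* ε)) (0<½* (0<½* 0<ε))
... | N , c = N , bound
  where
  -- A quarter of ε: two parts for the bound at index N, one for the drift of the tail, and one to
  -- spare.
  η = ½ ℚ.* (½ ℚ.* ε)
  0<η = 0<½* (0<½* 0<ε)
  near : ∀ n → N ℕ.≤ n → seq x N ℚ.≤ seq x n ℚ.+ η × seq x n ℚ.≤ seq x N ℚ.+ η
  near n le = ≤-by₁ (id₁ (seq x N) (seq x n) η) (ℚ.≤-trans (p≤∣p∣ _) d)
            , ≤-by₁ (id₂ (seq x N) (seq x n) η) (ℚ.≤-trans (-p≤∣p∣ _) d)
    where
    d = ℚ.<⇒≤ (c N n ℕ.≤-refl le)
    id₁ : ∀ a b e → (b ℚ.+ e) ℚ.- a ≡ e ℚ.- (a ℚ.- b)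
    id₁ = solve-∀ ℚ-ring
    id₂ : ∀ a b e → (a ℚ.+ e) ℚ.- b ≡ e ℚ.- (ℚ.- (a ℚ.- b))
    id₂ = solve-∀ ℚ-ring
  4η : η ℚ.+ η ℚ.+ (η ℚ.+ η) ≡ ε
  4η = ≡.trans (cong₂ ℚ._+_ (½*+½* (½ ℚ.* ε)) (½*+½* (½ ℚ.* ε))) (½*+½* ε)
  upper : seq x N ℚ.≤ r ℚ.+ (η ℚ.+ η)
  upper with seq x N ℚ.≤? r ℚ.+ (η ℚ.+ η)
  ... | yes p = p
  ... | no ¬p = contradiction (η , 0<η , N , λ n le →
      ≤-by₂ (id₁ (seq x N) (seq x n) r η) (ℚ.<⇒≤ (ℚ.≰⇒> ¬p)) (proj₁ (near n le))) h
    where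
    id₁ : ∀ a b r e → b ℚ.- (r ℚ.+ e) ≡ (a ℚ.- (r ℚ.+ (e ℚ.+ e))) ℚ.+ ((b ℚ.+ e) ℚ.- a)
    id₁ = solve-∀ ℚ-ring
  lower : ℚ.- seq x N ℚ.≤ r ℚ.+ (η ℚ.+ η)
  lower with ℚ.- seq x N ℚ.≤? r ℚ.+ (η ℚ.+ η)
  ... | yes p = p
  ... | no ¬p = contradiction (η , 0<η , N , λ n le →
      ≤-by₂ (id₁ (seq x N) (seq x n) r η) (ℚ.<⇒≤ (ℚ.≰⇒> ¬p)) (proj₂ (near n le))) k
    where
    id₁ : ∀ a b r e → (ℚ.- b) ℚ.- (r ℚ.+ e) ≡ ((ℚ.- a) ℚ.- (r ℚ.+ (e ℚ.+ e))) ℚ.+ ((a ℚ.+ e) ℚ.- b)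
    id₁ = solve-∀ ℚ-ring
  bound : ∀ n → N ℕ.≤ n → ∣ seq x n ∣ ℚ.≤ r ℚ.+ ε
  bound n le = subst (λ t → ∣ seq x n ∣ ℚ.≤ r ℚ.+ t) 4η (ℚ.≤-trans
    (∣∣-lub (≤-by₂ (id₁ (seq x N) (seq x n) r η) upper (proj₂ (near n le)))
            (≤-by₂ (id₂ (seq x N) (seq x n) r η) lower (proj₁ (near n le))))
    (≤-by₁ (id₃ r η) (ℚ.<⇒≤ 0<η)))
    where
    id₁ : ∀ a b r e → (r ℚ.+ (e ℚ.+ e ℚ.+ e)) ℚ.- b ≡ ((r ℚ.+ (e ℚ.+ e)) ℚ.- a) ℚ.+ ((a ℚ.+ e) ℚ.- b)
    id₁ = solve-∀ ℚ-ring
    id₂ : ∀ a b r e → (r ℚ.+ (e ℚ.+ e ℚ.+ e)) ℚ.- (ℚ.- b)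
      ≡ ((r ℚ.+ (e ℚ.+ e)) ℚ.- (ℚ.- a)) ℚ.+ ((b ℚ.+ e) ℚ.- a)
    id₂ = solve-∀ ℚ-ring
    id₃ : ∀ r e → (r ℚ.+ (e ℚ.+ e ℚ.+ (e ℚ.+ e))) ℚ.- (r ℚ.+ (e ℚ.+ e ℚ.+ e)) ≡ e ℚ.- 0ℚ
    id₃ = solve-∀ ℚ-ring

-- The shape of property I, open on the left and closed on the right. On the left, -r < x and r < -x
-- added at a common index would make the sum of two positive margins nonpositive.
∈[-r,r]⇒AbsBound : ∀ x {r} → fromℚ (ℚ.- r) <ᴿ x → x ≤ᴿ fromℚ r → AbsBound (seq x) r
∈[-r,r]⇒AbsBound x {r} (ε , 0<ε , M , h) x≤r = ≯⇒AbsBound x x≤r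
  λ { (δ , 0<δ , N , k) →
    <⇒≱ (ℚ.+-mono-< 0<ε 0<δ)
      (≤-by₂ (sum (seq x (M ℕ.⊔ N)) r ε δ) (h _ (ℕ.m≤m⊔n M N)) (k _ (ℕ.m≤n⊔m M N))) }
  where
  sum : ∀ x r ε δ → (0ℚ ℚ.+ 0ℚ) ℚ.- (ε ℚ.+ δ) ≡ (x ℚ.- (ℚ.- r ℚ.+ ε)) ℚ.+ (ℚ.- x ℚ.- (r ℚ.+ δ))
  sum = solve-∀ ℚ-ring

-- If y - 2h is negative, its absolute value 2h - y falls short of y by 2 (y - h) ≥ 2δ; otherwise
-- the shift gains 2h, and δ ≤ h suffices.
closer : ∀ {h δ y} → 0ℚ ℚ.≤ δ → δ ℚ.≤ h → h ℚ.+ δ ℚ.≤ y →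
  ∣ y ℚ.- (h ℚ.+ h) ∣ ℚ.+ δ ℚ.≤ ∣ y ∣
closer {h} {δ} {y} 0≤δ δ≤h h+δ≤y = ≤-by₁ (id₀ ∣ y ℚ.- (h ℚ.+ h) ∣ ∣ y ∣ δ)
  (ℚ.≤-trans (∣∣-lub
      (≤-by₂ (id₁ y h δ) (ℚ.≤-trans 0≤δ δ≤h) δ≤h)
      (≤-by₂ (id₂ y h δ) h+δ≤y (≤-by₂ {h} {y} (id₃ y h δ) h+δ≤y 0≤δ)))
    (ℚ.+-monoˡ-≤ (ℚ.- δ) (p≤∣p∣ y)))
  where
  id₀ : ∀ a b ε → b ℚ.- (a ℚ.+ ε) ≡ (b ℚ.- ε) ℚ.- a
  id₀ = solve-∀ ℚ-ring
  id₁ : ∀ y h ε → (y ℚ.- ε) ℚ.- (y ℚ.- (h ℚ.+ h)) ≡ (h ℚ.- 0ℚ) ℚ.+ (h ℚ.- ε)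
  id₁ = solve-∀ ℚ-ring
  id₂ : ∀ y h ε → (y ℚ.- ε) ℚ.- (ℚ.- (y ℚ.- (h ℚ.+ h))) ≡ (y ℚ.- (h ℚ.+ ε)) ℚ.+ (y ℚ.- h)
  id₂ = solve-∀ ℚ-ring
  id₃ : ∀ y h ε → y ℚ.- h ≡ (y ℚ.- (h ℚ.+ ε)) ℚ.+ (ε ℚ.- 0ℚ)
  id₃ = solve-∀ ℚ-ring

≤∣-2h∣⇒≯ : ∀ h y z → 0ℚ ℚ.< h → (∀ n → seq z n ≡ seq y n ℚ.- (h ℚ.+ h)) →
  ∣ y ∣ᴿ ≤ᴿ ∣ z ∣ᴿ → ¬ (fromℚ h <ᴿ y)
≤∣-2h∣⇒≯ h y z 0<h z≡y-2h y≤z (ε , 0<ε , N , far) = y≤z (δ , 0<δ , N , λ n le →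
  subst (λ t → ∣ t ∣ ℚ.+ δ ℚ.≤ ∣ seq y n ∣) (≡.sym (z≡y-2h n))
    (closer (ℚ.<⇒≤ 0<δ) (ℚ.p⊓q≤q ε h) (ℚ.≤-trans (ℚ.+-monoʳ-≤ h (ℚ.p⊓q≤p ε h)) (far n le))))
  where
  -- The given margin ε may exceed h, while `closer` needs a margin of at most h.
  δ = ε ℚ.⊓ h
  0<δ : 0ℚ ℚ.< δ
  0<δ with ℚ.⊓-sel ε h
  ... | inj₁ e = subst (0ℚ ℚ.<_) (≡.sym e) 0<ε
  ... | inj₂ e = subst (0ℚ ℚ.<_) (≡.sym e) 0<h

-- In a lattice of spacing 2h, a point that is no farther away than both of its neighbours lies
-- within h. The lower side is the upper one applied to the negatives.
∣∣≤∣±2h∣⇒AbsBound : ∀ h y z w → 0ℚ ℚ.< h →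
  (∀ n → seq z n ≡ seq y n ℚ.- (h ℚ.+ h)) → (∀ n → seq w n ≡ seq y n ℚ.+ (h ℚ.+ h)) →
  ∣ y ∣ᴿ ≤ᴿ ∣ z ∣ᴿ → ∣ y ∣ᴿ ≤ᴿ ∣ w ∣ᴿ → AbsBound (seq y) h
∣∣≤∣±2h∣⇒AbsBound h y z w 0<h z≡ w≡ y≤z y≤w = ≯⇒AbsBound y
  (≤∣-2h∣⇒≯ h y z 0<h z≡ y≤z)
  (≤∣-2h∣⇒≯ h (-ᴿ y) (-ᴿ w) 0<h
    (λ n → ≡.trans (cong ℚ.-_ (w≡ n)) (regroup (seq y n) h))
    λ { (ε , 0<ε , N , k) → y≤w (ε , 0<ε , N , λ n le →
      subst₂ (λ s t → s ℚ.+ ε ℚ.≤ t) (ℚ.∣-p∣≡∣p∣ (seq w n)) (ℚ.∣-p∣≡∣p∣ (seq y n)) (k n le)) })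
  where
  regroup : ∀ y h → ℚ.- (y ℚ.+ (h ℚ.+ h)) ≡ (ℚ.- y) ℚ.- (h ℚ.+ h)
  regroup = solve-∀ ℚ-ring

-- Integers and dyadic fractions in ℚ

toℚᵘ-fromInt : ∀ i → toℚᵘ (fromInt i) ℚᵘ.≃ mkℚᵘ i 0
toℚᵘ-fromInt i = ℚ.toℚᵘ-fromℚᵘ (mkℚᵘ i 0)

fromInt-+ : ∀ i j → fromInt (i ℤ.+ j) ≡ fromInt i ℚ.+ fromInt j
fromInt-+ i j = ℚ.toℚᵘ-injective (begin
  toℚᵘ (fromInt (i ℤ.+ j))                    ≈⟨ toℚᵘ-fromInt (i ℤ.+ j) ⟩
  mkℚᵘ (i ℤ.+ j) 0                            ≈⟨ *≡* (cong (ℤ._* 1ℤ) (≡.sym (cong₂ ℤ._+_ (ℤ.*-identityʳ i) (ℤ.*-identityʳ j)))) ⟩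
  mkℚᵘ i 0 ℚᵘ.+ mkℚᵘ j 0                      ≈⟨ ℚᵘ.+-cong (toℚᵘ-fromInt i) (toℚᵘ-fromInt j) ⟨
  toℚᵘ (fromInt i) ℚᵘ.+ toℚᵘ (fromInt j)      ≈⟨ ℚ.toℚᵘ-homo-+ (fromInt i) (fromInt j) ⟨
  toℚᵘ (fromInt i ℚ.+ fromInt j)              ∎)
  where open ℚᵘ.≃-Reasoning

fromInt-* : ∀ i j → fromInt (i ℤ.* j) ≡ fromInt i ℚ.* fromInt j
fromInt-* i j = ℚ.toℚᵘ-injective (begin
  toℚᵘ (fromInt (i ℤ.* j))                    ≈⟨ toℚᵘ-fromInt (i ℤ.* j) ⟩
  mkℚᵘ (i ℤ.* j) 0                            ≈⟨ *≡* ≡.refl ⟩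
  mkℚᵘ i 0 ℚᵘ.* mkℚᵘ j 0                      ≈⟨ ℚᵘ.*-cong (toℚᵘ-fromInt i) (toℚᵘ-fromInt j) ⟨
  toℚᵘ (fromInt i) ℚᵘ.* toℚᵘ (fromInt j)      ≈⟨ ℚ.toℚᵘ-homo-* (fromInt i) (fromInt j) ⟨
  toℚᵘ (fromInt i ℚ.* fromInt j)              ∎)
  where open ℚᵘ.≃-Reasoning

fromInt-neg : ∀ i → fromInt (ℤ.- i) ≡ ℚ.- fromInt i
fromInt-neg i = ℚ.toℚᵘ-injective (begin
  toℚᵘ (fromInt (ℤ.- i))                      ≈⟨ toℚᵘ-fromInt (ℤ.- i) ⟩
  ℚᵘ.- mkℚᵘ i 0                               ≈⟨ ℚᵘ.-‿cong (toℚᵘ-fromInt i) ⟨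
  ℚᵘ.- toℚᵘ (fromInt i)                       ≈⟨ ℚ.toℚᵘ-homo‿- (fromInt i) ⟨
  toℚᵘ (ℚ.- fromInt i)                        ∎)
  where open ℚᵘ.≃-Reasoning

fromInt-injective : ∀ {i j} → fromInt i ≡ fromInt j → i ≡ j
fromInt-injective {i} {j} e with
  ℚᵘ.≃-trans (ℚᵘ.≃-sym (toℚᵘ-fromInt i)) (ℚᵘ.≃-trans (ℚ.toℚᵘ-cong e) (toℚᵘ-fromInt j))
... | *≡* h = ≡.trans (≡.sym (ℤ.*-identityʳ i)) (≡.trans h (ℤ.*-identityʳ j))

fromInt-mono-≤ : ∀ {i j} → i ℤ.≤ j → fromInt i ℚ.≤ fromInt j
fromInt-mono-≤ {i} {j} i≤j = ℚ.toℚᵘ-cancel-≤ (begin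
  toℚᵘ (fromInt i)   ≃⟨ toℚᵘ-fromInt i ⟩
  mkℚᵘ i 0           ≤⟨ *≤* (ℤ.*-monoʳ-≤-nonNeg 1ℤ i≤j) ⟩
  mkℚᵘ j 0           ≃⟨ toℚᵘ-fromInt j ⟨
  toℚᵘ (fromInt j)   ∎)
  where open ℚᵘ.≤-Reasoning

fromInt-*-/ : ∀ i d .{{_ : ℕ.NonZero d}} → fromInt (+ d) ℚ.* (i ℚ./ d) ≡ fromInt i
fromInt-*-/ i d@(suc d-1) = ℚ.toℚᵘ-injective (begin
  toℚᵘ (fromInt (+ d) ℚ.* (i ℚ./ d))          ≈⟨ ℚ.toℚᵘ-homo-* (fromInt (+ d)) (i ℚ./ d) ⟩
  toℚᵘ (fromInt (+ d)) ℚᵘ.* toℚᵘ (i ℚ./ d)    ≈⟨ ℚᵘ.*-cong (toℚᵘ-fromInt (+ d)) (ℚ.toℚᵘ-fromℚᵘ (mkℚᵘ i d-1)) ⟩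
  mkℚᵘ (+ d) 0 ℚᵘ.* mkℚᵘ i d-1                ≈⟨ *≡* (≡.trans (ℤ.*-identityʳ _) (≡.trans (ℤ.*-comm (+ d) i)
                                                   (cong (λ e → i ℤ.* + e) (≡.sym (ℕ.+-identityʳ d))))) ⟩
  mkℚᵘ i 0                                    ≈⟨ toℚᵘ-fromInt i ⟨
  toℚᵘ (fromInt i)                            ∎)
  where open ℚᵘ.≃-Reasoning

fromInt-↧-* : ∀ r → fromInt (ℚ.↧ r) ℚ.* r ≡ fromInt (ℚ.↥ r)
fromInt-↧-* r = ≡.trans (cong (fromInt (ℚ.↧ r) ℚ.*_) (≡.sym (ℚ.↥p/↧p≡p r)))
  (fromInt-*-/ (ℚ.↥ r) (ℚ.↧ₙ r))

*-cancelˡ-≡ : ∀ d .{{_ : NonZero d}} {p q} → d ℚ.* p ≡ d ℚ.* q → p ≡ q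
*-cancelˡ-≡ d {p} {q} e = ≡.trans (≡.sym (cancel p)) (≡.trans (cong (ℚ.1/ d ℚ.*_) e) (cancel q))
  where
  cancel : ∀ q → ℚ.1/ d ℚ.* (d ℚ.* q) ≡ q
  cancel q = ≡.trans (≡.sym (ℚ.*-assoc (ℚ.1/ d) d q))
    (≡.trans (cong (ℚ._* q) (ℚ.*-inverseˡ d)) (ℚ.*-identityˡ q))

*-≢0 : ∀ {p q} → ¬ p ≡ 0ℚ → ¬ q ≡ 0ℚ → ¬ p ℚ.* q ≡ 0ℚ
*-≢0 {p} p≢0 q≢0 pq≡0 = q≢0 (*-cancelˡ-≡ p {{ℚ.≢-nonZero p≢0}} (≡.trans pq≡0 (≡.sym (ℚ.*-zeroʳ p))))

1≤∣fromInt∣ : ∀ i → ¬ i ≡ 0ℤ → 1ℚ ℚ.≤ ∣ fromInt i ∣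
1≤∣fromInt∣ (+ zero)  i≢0 = contradiction ≡.refl i≢0
1≤∣fromInt∣ (+ suc n) _   =
  ℚ.≤-trans (fromInt-mono-≤ {1ℤ} {+ suc n} (ℤ.+≤+ (ℕ.s≤s ℕ.z≤n))) (p≤∣p∣ (fromInt (+ suc n)))
1≤∣fromInt∣ -[1+ n ]  _   = subst (λ t → 1ℚ ℚ.≤ ∣ t ∣) (≡.sym (fromInt-neg (+ suc n)))
  (subst (1ℚ ℚ.≤_) (≡.sym (ℚ.∣-p∣≡∣p∣ (fromInt (+ suc n)))) (1≤∣fromInt∣ (+ suc n) λ ()))

nonZero-integer : ∀ {r} → ∃ (λ i → r ≡ fromInt i) → ¬ r ≡ 0ℚ → 1ℚ ℚ.≤ ∣ r ∣
nonZero-integer (i , ≡.refl) r≢0 = 1≤∣fromInt∣ i λ i≡0 → r≢0 (cong fromInt i≡0)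

≤-fromInt-∣↥∣ : ∀ r → r ℚ.≤ fromInt (+ ℤ.∣ ℚ.↥ r ∣)
≤-fromInt-∣↥∣ r@(ℚ.mkℚ n d-1 _) = ℚ.toℚᵘ-cancel-≤ (begin
  mkℚᵘ n d-1                    ≤⟨ *≤* (le n) ⟩
  mkℚᵘ (+ ℤ.∣ n ∣) 0            ≃⟨ toℚᵘ-fromInt (+ ℤ.∣ n ∣) ⟨
  toℚᵘ (fromInt (+ ℤ.∣ n ∣))    ∎)
  where
  open ℚᵘ.≤-Reasoning
  le : ∀ n → n ℤ.* 1ℤ ℤ.≤ + ℤ.∣ n ∣ ℤ.* + suc d-1
  le (+ n)    = subst₂ ℤ._≤_ (≡.sym (ℤ.*-identityʳ (+ n))) (ℤ.pos-* n (suc d-1))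
    (ℤ.+≤+ (ℕ.m≤m*n n (suc d-1)))
  le -[1+ n ] = ℤ.-≤+

archimedean : ∀ W {ε} → 0ℚ ℚ.< ε → ∃ λ k → W ℚ.≤ fromInt (+ k) ℚ.* ε
archimedean W {ε} 0<ε = ℤ.∣ ℚ.↥ r ∣ , subst (ℚ._≤ fromInt (+ ℤ.∣ ℚ.↥ r ∣) ℚ.* ε)
  (≡.trans (ℚ.*-assoc W (ℚ.1/ ε) ε) (≡.trans (cong (W ℚ.*_) (ℚ.*-inverseˡ ε)) (ℚ.*-identityʳ W)))
  (ℚ.*-monoʳ-≤-nonNeg ε (≤-fromInt-∣↥∣ r))
  where
  instance
    ε-pos : ℚ.Positive ε
    ε-pos = ℚ.positive 0<ε
    ε-nonNeg : ℚ.NonNegative ε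
    ε-nonNeg = ℚ.pos⇒nonNeg ε
    ε≢0 : NonZero ε
    ε≢0 = ℚ.pos⇒nonZero ε
  r = W ℚ.* ℚ.1/ ε

-- The form in which a ring homomorphism is forced on the integers; it serves the real and the
-- 2-adic embedding alike.
ℤ-induction : ∀ {ℓ} (P : ℤ → Set ℓ) → P 0ℤ → (∀ i → P i → P (1ℤ ℤ.+ i)) → (∀ i → P i → P (ℤ.- i)) →
  ∀ i → P i
ℤ-induction P z s m = go
  where
  nonNeg : ∀ n → P (+ n)
  nonNeg zero    = z
  nonNeg (suc n) = s (+ n) (nonNeg n)
  go : ∀ i → P i
  go (+ n)    = nonNeg n
  go -[1+ n ] = m (+ suc n) (nonNeg (suc n))

-- The ring ℤ[1/2]. The fraction need not be reduced, so sums and products can simply add exponents.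
Dyadic : ℚ → Set
Dyadic r = ∃₂ λ k i → fromInt (2^ k) ℚ.* r ≡ fromInt i

fromInt-2^-+ : ∀ k l → fromInt (2^ (k ℕ.+ l)) ≡ fromInt (2^ k) ℚ.* fromInt (2^ l)
fromInt-2^-+ k l = ≡.trans (cong fromInt
    (≡.trans (cong +_ (ℕ.^-distribˡ-+-* 2 k l)) (ℤ.pos-* (2 ℕ.^ k) (2 ℕ.^ l))))
  (fromInt-* (2^ k) (2^ l))

Dyadic-fromInt : ∀ i → Dyadic (fromInt i)
Dyadic-fromInt i = 0 , i , ℚ.*-identityˡ (fromInt i)

Dyadic-+ : ∀ {r s} → Dyadic r → Dyadic s → Dyadic (r ℚ.+ s)
Dyadic-+ {r} {s} (k , i , e) (l , j , f) = k ℕ.+ l , 2^ l ℤ.* i ℤ.+ 2^ k ℤ.* j , (begin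
  fromInt (2^ (k ℕ.+ l)) ℚ.* (r ℚ.+ s)         ≡⟨ cong (ℚ._* (r ℚ.+ s)) (fromInt-2^-+ k l) ⟩
  K ℚ.* L ℚ.* (r ℚ.+ s)                        ≡⟨ regroup K L r s ⟩
  L ℚ.* (K ℚ.* r) ℚ.+ K ℚ.* (L ℚ.* s)          ≡⟨ cong₂ (λ x y → L ℚ.* x ℚ.+ K ℚ.* y) e f ⟩
  L ℚ.* fromInt i ℚ.+ K ℚ.* fromInt j          ≡⟨ cong₂ ℚ._+_ (fromInt-* (2^ l) i) (fromInt-* (2^ k) j) ⟨
  fromInt (2^ l ℤ.* i) ℚ.+ fromInt (2^ k ℤ.* j) ≡⟨ fromInt-+ (2^ l ℤ.* i) (2^ k ℤ.* j) ⟨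
  fromInt (2^ l ℤ.* i ℤ.+ 2^ k ℤ.* j)          ∎)
  where
  open ≡.≡-Reasoning
  K = fromInt (2^ k)
  L = fromInt (2^ l)
  regroup : ∀ K L r s → K ℚ.* L ℚ.* (r ℚ.+ s) ≡ L ℚ.* (K ℚ.* r) ℚ.+ K ℚ.* (L ℚ.* s)
  regroup = solve-∀ ℚ-ring

Dyadic-* : ∀ {r s} → Dyadic r → Dyadic s → Dyadic (r ℚ.* s)
Dyadic-* {r} {s} (k , i , e) (l , j , f) = k ℕ.+ l , i ℤ.* j , (begin
  fromInt (2^ (k ℕ.+ l)) ℚ.* (r ℚ.* s)         ≡⟨ cong (ℚ._* (r ℚ.* s)) (fromInt-2^-+ k l) ⟩
  K ℚ.* L ℚ.* (r ℚ.* s)                        ≡⟨ regroup K L r s ⟩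
  (K ℚ.* r) ℚ.* (L ℚ.* s)                      ≡⟨ cong₂ ℚ._*_ e f ⟩
  fromInt i ℚ.* fromInt j                      ≡⟨ fromInt-* i j ⟨
  fromInt (i ℤ.* j)                            ∎)
  where
  open ≡.≡-Reasoning
  K = fromInt (2^ k)
  L = fromInt (2^ l)
  regroup : ∀ K L r s → K ℚ.* L ℚ.* (r ℚ.* s) ≡ (K ℚ.* r) ℚ.* (L ℚ.* s)
  regroup = solve-∀ ℚ-ring

Dyadic-neg : ∀ {r} → Dyadic r → Dyadic (ℚ.- r)
Dyadic-neg {r} (k , i , e) = k , ℤ.- i ,
  ≡.trans (≡.sym (ℚ.neg-distribʳ-* (fromInt (2^ k)) r)) (≡.trans (cong ℚ.-_ e) (≡.sym (fromInt-neg i)))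

Dyadic-⌊⌋₂ : ∀ u → Dyadic ⌊ u ⌋₂
Dyadic-⌊⌋₂ (x /2^ k) = k , + digitSum x (suc k) ,
  fromInt-*-/ (+ digitSum x (suc k)) (2 ℕ.^ k) {{ℕ.m^n≢0 2 k}}

-- After a step with parity ε the new quotient is at most radius ε in ℝ and
-- divisible by 2 ^ level ε in ℤ₂.
radius : Parity → ℚ
radius 0ℙ = 1ℚ
radius 1ℙ = ½

level : Parity → ℕ
level 0ℙ = 1
level 1ℙ = 0

0≤radius : ∀ ε → 0ℚ ℚ.≤ radius ε
0≤radius 0ℙ = ℚ.<⇒≤ (ℚ.positive⁻¹ 1ℚ)
0≤radius 1ℙ = ℚ.<⇒≤ (ℚ.positive⁻¹ ½)

radius≤1 : ∀ ε → radius ε ℚ.≤ 1ℚ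
radius≤1 0ℙ = ℚ.≤-refl
radius≤1 1ℙ = ≤-by₁ {½} {1ℚ} ≡.refl (ℚ.<⇒≤ (ℚ.positive⁻¹ ½))

-- The product of the radii of the first n quotients. The bound bₙ on |qₙ α - pₙ| is
-- `decay (suc n)`, as that difference is a product of n + 1 quotients.
decay : ℕ → ℚ
decay zero    = 1ℚ
decay (suc n) = decay n ℚ.* radius (parity n)

0≤decay : ∀ n → 0ℚ ℚ.≤ decay n
0≤decay zero    = ℚ.<⇒≤ (ℚ.positive⁻¹ 1ℚ)
0≤decay (suc n) = subst (ℚ._≤ decay (suc n)) (ℚ.*-zeroˡ (radius (parity n)))
  (ℚ.*-monoʳ-≤-nonNeg (radius (parity n)) {{ℚ.nonNegative (0≤radius (parity n))}} (0≤decay n))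

decay≤1 : ∀ n → decay n ℚ.≤ 1ℚ
decay≤1 zero    = ℚ.≤-refl
decay≤1 (suc n) = *-mono-≤-nonNeg (0≤radius (parity n)) (ℚ.<⇒≤ (ℚ.positive⁻¹ 1ℚ))
  (decay≤1 n) (radius≤1 (parity n))

decay-2+ : ∀ n → decay (suc (suc n)) ≡ decay n ℚ.* ½
decay-2+ n = ≡.trans (ℚ.*-assoc (decay n) (radius (parity n)) (radius (parity (suc n))))
  (cong (decay n ℚ.*_) (two n))
  where
  two : ∀ n → radius (parity n) ℚ.* radius (parity (suc n)) ≡ ½
  two zero          = ≡.refl
  two (suc zero)    = ≡.refl
  two (suc (suc n)) = two n

-- Halving every second step beats the rate 1 / (k + 1), because (k + 2) / 2 ≤ k + 1. A linear rate
-- is enough for the archimedean property.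
decay-bound : ∀ k n → k ℕ.+ k ℕ.≤ n → decay n ℚ.* fromInt (+ suc k) ℚ.≤ 1ℚ
decay-bound zero    n _ = subst (ℚ._≤ 1ℚ) (≡.sym (ℚ.*-identityʳ (decay n))) (decay≤1 n)
decay-bound (suc k) (suc zero) (ℕ.s≤s le) with () ← subst (ℕ._≤ 0) (ℕ.+-suc k k) le
decay-bound (suc k) (suc (suc n)) (ℕ.s≤s le) = begin
  decay (suc (suc n)) ℚ.* fromInt (+ suc (suc k))
    ≡⟨ cong₂ ℚ._*_ (decay-2+ n) (fromInt-+ 1ℤ (+ suc k)) ⟩
  decay n ℚ.* ½ ℚ.* (1ℚ ℚ.+ K)
    ≤⟨ ℚ.*-monoˡ-≤-nonNeg (decay n ℚ.* ½) {{ℚ.nonNegative 0≤d½}} (ℚ.+-monoˡ-≤ K 1≤K) ⟩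
  decay n ℚ.* ½ ℚ.* (K ℚ.+ K)
    ≡⟨ regroup (decay n) K ⟩
  decay n ℚ.* K
    ≤⟨ decay-bound k n (ℕ.≤-pred (subst (ℕ._≤ suc n) (ℕ.+-suc k k) le)) ⟩
  1ℚ ∎
  where
  open ℚ.≤-Reasoning
  K = fromInt (+ suc k)
  1≤K : 1ℚ ℚ.≤ K
  1≤K = fromInt-mono-≤ {1ℤ} {+ suc k} (ℤ.+≤+ (ℕ.s≤s ℕ.z≤n))
  0≤d½ : 0ℚ ℚ.≤ decay n ℚ.* ½
  0≤d½ = subst (ℚ._≤ decay n ℚ.* ½) (ℚ.*-zeroˡ ½) (ℚ.*-monoʳ-≤-nonNeg ½ (0≤decay n))
  regroup : ∀ d K → d ℚ.* ½ ℚ.* (K ℚ.+ K) ≡ d ℚ.* K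
  regroup d K = ≡.trans (assoc d ½ K) (cong (d ℚ.*_) (ℚ.*-identityˡ K))
    where
    assoc : ∀ d h K → d ℚ.* h ℚ.* (K ℚ.+ K) ≡ d ℚ.* ((h ℚ.+ h) ℚ.* K)
    assoc = solve-∀ ℚ-ring

-- Multiplied by k + 1, the claim follows from W ≤ k ε < (k + 1) ε; the additional ε gives
-- strictness even for W = 0.
decay→0 : ∀ W {ε} → 0ℚ ℚ.≤ W → 0ℚ ℚ.< ε → Eventually λ n → decay n ℚ.* W ℚ.< ε
decay→0 W {ε} 0≤W 0<ε with k , W≤kε ← archimedean W 0<ε = k ℕ.+ k , λ n le →
  ℚ.*-cancelʳ-<-nonNeg (K k) {{ℚ.nonNegative (0≤K k)}} (begin-strict
    decay n ℚ.* W ℚ.* K k                     ≡⟨ swap (decay n) W (K k) ⟩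
    decay n ℚ.* K k ℚ.* W                     ≤⟨ ℚ.*-monoʳ-≤-nonNeg W {{ℚ.nonNegative 0≤W}} (decay-bound k n le) ⟩
    1ℚ ℚ.* W                                  ≡⟨ ℚ.*-identityˡ W ⟩
    W                                         ≤⟨ W≤kε ⟩
    fromInt (+ k) ℚ.* ε                       ≡⟨ ℚ.+-identityˡ _ ⟨
    0ℚ ℚ.+ fromInt (+ k) ℚ.* ε                <⟨ ℚ.+-monoˡ-< (fromInt (+ k) ℚ.* ε) 0<ε ⟩
    ε ℚ.+ fromInt (+ k) ℚ.* ε                 ≡⟨ cong (ℚ._+ fromInt (+ k) ℚ.* ε) (ℚ.*-identityʳ ε) ⟨
    ε ℚ.* 1ℚ ℚ.+ fromInt (+ k) ℚ.* ε          ≡⟨ factor ε (fromInt (+ k)) ⟩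
    ε ℚ.* (1ℚ ℚ.+ fromInt (+ k))              ≡⟨ cong (ε ℚ.*_) (fromInt-+ 1ℤ (+ k)) ⟨
    ε ℚ.* K k                                 ∎)
  where
  open ℚ.≤-Reasoning
  K : ℕ → ℚ
  K k = fromInt (+ suc k)
  0≤K : ∀ k → 0ℚ ℚ.≤ K k
  0≤K k = fromInt-mono-≤ {0ℤ} {+ suc k} (ℤ.+≤+ ℕ.z≤n)
  swap : ∀ d w k → d ℚ.* w ℚ.* k ≡ d ℚ.* k ℚ.* w
  swap = solve-∀ ℚ-ring
  factor : ∀ e k → e ℚ.* 1ℚ ℚ.+ k ℚ.* e ≡ e ℚ.* (1ℚ ℚ.+ k)
  factor = solve-∀ ℚ-ring

-- Inequalities for the norm argument.

common-denominator : ∀ r s → ∃ λ d → ¬ fromInt d ≡ 0ℚ ×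
  (∃₂ λ i j → fromInt d ℚ.* r ≡ fromInt i × fromInt d ℚ.* s ≡ fromInt j)
common-denominator r s =
  ℚ.↧ r ℤ.* ℚ.↧ s ,
  (λ e → contradiction (fromInt-injective {ℚ.↧ r ℤ.* ℚ.↧ s} {0ℤ} e) λ ()) ,
  ℚ.↥ r ℤ.* ℚ.↧ s , ℚ.↧ r ℤ.* ℚ.↥ s , (begin
    fromInt (ℚ.↧ r ℤ.* ℚ.↧ s) ℚ.* r   ≡⟨ cong (ℚ._* r) (fromInt-* (ℚ.↧ r) (ℚ.↧ s)) ⟩
    D ℚ.* E ℚ.* r                     ≡⟨ regroup D E r ⟩
    D ℚ.* r ℚ.* E                     ≡⟨ cong (ℚ._* E) (fromInt-↧-* r) ⟩
    fromInt (ℚ.↥ r) ℚ.* E             ≡⟨ fromInt-* (ℚ.↥ r) (ℚ.↧ s) ⟨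
    fromInt (ℚ.↥ r ℤ.* ℚ.↧ s)         ∎) , (begin
    fromInt (ℚ.↧ r ℤ.* ℚ.↧ s) ℚ.* s   ≡⟨ cong (ℚ._* s) (fromInt-* (ℚ.↧ r) (ℚ.↧ s)) ⟩
    D ℚ.* E ℚ.* s                     ≡⟨ ℚ.*-assoc D E s ⟩
    D ℚ.* (E ℚ.* s)                   ≡⟨ cong (D ℚ.*_) (fromInt-↧-* s) ⟩
    D ℚ.* fromInt (ℚ.↥ s)             ≡⟨ fromInt-* (ℚ.↧ r) (ℚ.↥ s) ⟨
    fromInt (ℚ.↧ r ℤ.* ℚ.↥ s)         ∎)
  where
  open ≡.≡-Reasoning
  D E : ℚ
  D = fromInt (ℚ.↧ r)
  E = fromInt (ℚ.↧ s)
  regroup : ∀ x y t → x ℚ.* y ℚ.* t ≡ x ℚ.* t ℚ.* y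
  regroup = solve-∀ ℚ-ring

-- The divergence of |qₙ| enters in this form, with `c` and `q` standing for absolute values: the
-- error b / q drops below ε once ε q ≤ b is refuted. Multiplying the norm inequality by ε makes ε q
-- appear, and ε q ≤ b ≤ 1 bounds the right side by b c (T + ε), which is below ε.
denominator-not-small : ∀ {c b q T ε} → 0ℚ ℚ.≤ c → 0ℚ ℚ.≤ b → b ℚ.≤ 1ℚ → 0ℚ ℚ.≤ T → 0ℚ ℚ.< ε →
  1ℚ ℚ.≤ c ℚ.* (b ℚ.* (q ℚ.* T ℚ.+ b)) → b ℚ.* (c ℚ.* (T ℚ.+ ε)) ℚ.< ε → ¬ ε ℚ.* q ℚ.≤ b
denominator-not-small {c} {b} {q} {T} {ε} 0≤c 0≤b b≤1 0≤T 0<ε 1≤ small εq≤b = <⇒≱ small (begin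
  ε
    ≡⟨ ℚ.*-identityʳ ε ⟨
  ε ℚ.* 1ℚ
    ≤⟨ ℚ.*-monoˡ-≤-nonNeg ε {{0≤ε}} 1≤ ⟩
  ε ℚ.* (c ℚ.* (b ℚ.* (q ℚ.* T ℚ.+ b)))
    ≡⟨ regroup ε c b q T ⟩
  b ℚ.* c ℚ.* (ε ℚ.* q ℚ.* T ℚ.+ b ℚ.* ε)
    ≤⟨ ℚ.*-monoˡ-≤-nonNeg (b ℚ.* c) {{0≤bc}} (ℚ.+-mono-≤
         (ℚ.*-monoʳ-≤-nonNeg T {{ℚ.nonNegative 0≤T}} (ℚ.≤-trans εq≤b b≤1))
         (ℚ.*-monoʳ-≤-nonNeg ε {{0≤ε}} b≤1)) ⟩
  b ℚ.* c ℚ.* (1ℚ ℚ.* T ℚ.+ 1ℚ ℚ.* ε)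
    ≡⟨ cong₂ (λ x y → b ℚ.* c ℚ.* (x ℚ.+ y)) (ℚ.*-identityˡ T) (ℚ.*-identityˡ ε) ⟩
  b ℚ.* c ℚ.* (T ℚ.+ ε)
    ≡⟨ ℚ.*-assoc b c (T ℚ.+ ε) ⟩
  b ℚ.* (c ℚ.* (T ℚ.+ ε))
    ∎)
  where
  open ℚ.≤-Reasoning
  0≤ε : ℚ.NonNegative ε
  0≤ε = ℚ.nonNegative (ℚ.<⇒≤ 0<ε)
  0≤bc : ℚ.NonNegative (b ℚ.* c)
  0≤bc = ℚ.nonNeg*nonNeg⇒nonNeg b {{ℚ.nonNegative 0≤b}} c {{ℚ.nonNegative 0≤c}}
  regroup : ∀ ε c b q T → ε ℚ.* (c ℚ.* (b ℚ.* (q ℚ.* T ℚ.+ b))) ≡ b ℚ.* c ℚ.* (ε ℚ.* q ℚ.* T ℚ.+ b ℚ.* ε)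
  regroup = solve-∀ ℚ-ring

1/*-< : ∀ q .{{_ : NonZero q}} {b ε} → b ℚ.< ε ℚ.* ∣ q ∣ → ∣ ℚ.1/ q ∣ ℚ.* b ℚ.< ε
1/*-< q {b} {ε} h = subst (∣ ℚ.1/ q ∣ ℚ.* b ℚ.<_)
  (≡.trans (regroup (∣ ℚ.1/ q ∣) ε (∣ q ∣))
    (≡.trans (cong (ε ℚ.*_) (≡.trans (≡.sym (ℚ.∣p*q∣≡∣p∣*∣q∣ (ℚ.1/ q) q)) (cong ∣_∣ (ℚ.*-inverseˡ q))))
      (ℚ.*-identityʳ ε)))
  (ℚ.*-monoʳ-<-pos (∣ ℚ.1/ q ∣) {{ℚ.nonNeg∧nonZero⇒pos (∣ ℚ.1/ q ∣) {{ℚ.∣-∣-nonNeg (ℚ.1/ q)}} {{∣1/q∣≢0}}}} h)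
  where
  ∣1/q∣≢0 : NonZero ∣ ℚ.1/ q ∣
  ∣1/q∣≢0 = ℚ.≢-nonZero λ e → contradiction
    (≡.trans (≡.sym (ℚ.*-inverseˡ q)) (≡.trans (cong (ℚ._* q) (ℚ.∣p∣≡0⇒p≡0 (ℚ.1/ q) e)) (ℚ.*-zeroˡ q))) ℚ.1≢0
  regroup : ∀ i ε q → i ℚ.* (ε ℚ.* q) ≡ ε ℚ.* (i ℚ.* q)
  regroup = solve-∀ ℚ-ring

-- Quadratic fields and their embeddings

module Convergence (K : QuadraticField c ℓ) where
  open QuadraticField K
  open IsField isField
  private module ι = RingMorphisms.IsRingHomomorphism ι-hom
  open ι public using ()
    renaming (+-homo to ι-+; *-homo to ι-*; -‿homo to ι-neg; 0#-homo to ι-0; 1#-homo to ι-1)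

  private
    K-ring : ACR.AlmostCommutativeRing c ℓ
    K-ring = ACR.fromCommutativeRing commutativeRing

    ι-morphism : ℚ.+-*-rawRing ACR.-Raw-AlmostCommutative⟶ K-ring
    ι-morphism = record
      { ⟦_⟧ = ι ; +-homo = ι-+ ; *-homo = ι-* ; -‿homo = ι-neg ; 0-homo = ι-0 ; 1-homo = ι-1 }

  open Algebra.Solver.Ring ℚ.+-*-rawRing K-ring ι-morphism
    (λ p q → Maybe.map (λ e → reflexive (cong ι e)) (dec⇒maybe (p ℚ.≟ q))) public
    using (solve; _:=_; _:+_; _:*_; _:-_; :-_; con)

  open Relation.Binary.Reasoning.Setoid setoid

  ι-cong : ∀ {p q} → p ≡ q → ι p ≈ ι q
  ι-cong e = reflexive (cong ι e)

  ι-minus : ∀ p q → ι (p ℚ.- q) ≈ ι p - ι q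
  ι-minus p q = trans (ι-+ p (ℚ.- q)) (+-congˡ (ι-neg q))

  ι-solve : ∀ p .{{_ : NonZero p}} {q x} → ι q ≈ ι p * x → x ≈ ι (q ÷ p)
  ι-solve p {q} {x} e = begin
    x                           ≈⟨ *-identityˡ x ⟨
    1# * x                      ≈⟨ *-congʳ (trans (sym ι-1) (ι-cong (≡.sym (ℚ.*-inverseˡ p)))) ⟩
    ι (ℚ.1/ p ℚ.* p) * x        ≈⟨ *-congʳ (ι-* (ℚ.1/ p) p) ⟩
    ι (ℚ.1/ p) * ι p * x        ≈⟨ *-assoc _ _ _ ⟩
    ι (ℚ.1/ p) * (ι p * x)      ≈⟨ *-congˡ e ⟨
    ι (ℚ.1/ p) * ι q            ≈⟨ *-comm _ _ ⟩
    ι q * ι (ℚ.1/ p)            ≈⟨ ι-* q (ℚ.1/ p) ⟨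
    ι (q ÷ p)                   ∎

  x*y≈0⇒y≈0 : ∀ {x y} → ¬ x ≈ 0# → x * y ≈ 0# → y ≈ 0#
  x*y≈0⇒y≈0 {x} {y} x≉0 xy≈0 with x⁻¹ , xx⁻¹≈1 ← inverse x x≉0 = begin
    y                ≈⟨ *-identityʳ y ⟨
    y * 1#           ≈⟨ *-congˡ xx⁻¹≈1 ⟨
    y * (x * x⁻¹)    ≈⟨ solve 3 (λ x y z → y :* (x :* z) := (x :* y) :* z) refl x y x⁻¹ ⟩
    x * y * x⁻¹      ≈⟨ *-congʳ xy≈0 ⟩
    0# * x⁻¹         ≈⟨ zeroˡ x⁻¹ ⟩
    0#               ∎

  -- Cramer's rule for the coordinates of 1, α and α² in a basis of K over ℚ.
  quadratic-relation : ∀ {α} → ¬ IsRational α → ∃₂ λ t ν → α * (ι t - α) ≈ ι ν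
  quadratic-relation {α} α∉ℚ =
    let r₁ , s₁ , eq₁ = spanning 1#
        r₂ , s₂ , eq₂ = spanning α
        r₃ , s₃ , eq₃ = spanning (α * α)
    in cramer r₁ s₁ r₂ s₂ r₃ s₃ eq₁ eq₂ eq₃
    where
    module _ (r₁ s₁ r₂ s₂ r₃ s₃ : ℚ)
      (eq₁ : 1# ≈ ι r₁ * e₁ + ι s₁ * e₂)
      (eq₂ : α ≈ ι r₂ * e₁ + ι s₂ * e₂)
      (eq₃ : α * α ≈ ι r₃ * e₁ + ι s₃ * e₂) where

      det : ℚ → ℚ → ℚ → ℚ → ℚ
      det a b c d = a ℚ.* d ℚ.- c ℚ.* b

      ι-det : ∀ a b c d → ι (det a b c d) ≈ ι a * ι d - ι c * ι b
      ι-det a b c d = trans (ι-minus (a ℚ.* d) (c ℚ.* b)) (+-cong (ι-* a d) (-‿cong (ι-* c b)))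

      δ = det r₁ s₁ r₂ s₂

      degenerate : δ ≡ 0ℚ → ∀ x y → ι y - ι x * α ≈ 0# → x ≡ 0ℚ
      degenerate δ≡0 x y e with x ℚ.≟ 0ℚ
      ... | yes x≡0 = x≡0
      ... | no  x≢0 = contradiction
        (_ , ι-solve x {{ℚ.≢-nonZero x≢0}} (begin
          ι y                            ≈⟨ solve 2 (λ y z → y := (y :- z) :+ z) refl (ι y) (ι x * α) ⟩
          (ι y - ι x * α) + ι x * α      ≈⟨ +-congʳ e ⟩
          0# + ι x * α                   ≈⟨ +-identityˡ _ ⟩
          ι x * α                        ∎)) α∉ℚ

      -- If the coordinate vectors of 1 and α were dependent, then s₂ - s₁ α and r₂ - r₁ α would
      -- vanish. As α is irrational, this forces s₁ = r₁ = 0, so that 1 would have zero coordinates.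
      δ≢0 : ¬ δ ≡ 0ℚ
      δ≢0 δ≡0 = 1≉0 (begin
        1#                          ≈⟨ eq₁ ⟩
        ι r₁ * e₁ + ι s₁ * e₂       ≈⟨ +-cong (*-congʳ (ι-cong r₁≡0)) (*-congʳ (ι-cong s₁≡0)) ⟩
        ι 0ℚ * e₁ + ι 0ℚ * e₂       ≈⟨ solve 2 (λ x y → con 0ℚ :* x :+ con 0ℚ :* y := con 0ℚ) refl e₁ e₂ ⟩
        ι 0ℚ                        ≈⟨ ι-0 ⟩
        0#                          ∎)
        where
        ιδ≈0 : ι r₁ * ι s₂ - ι r₂ * ι s₁ ≈ 0#
        ιδ≈0 = trans (sym (ι-det r₁ s₁ r₂ s₂)) (trans (ι-cong δ≡0) ι-0)
        expand : ∀ x y → ι y - ι x * α ≈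
          ι y * (ι r₁ * e₁ + ι s₁ * e₂) - ι x * (ι r₂ * e₁ + ι s₂ * e₂)
        expand x y = +-cong (trans (sym (*-identityʳ _)) (*-congˡ eq₁)) (-‿cong (*-congˡ eq₂))
        s₁≡0 = degenerate δ≡0 s₁ s₂ (begin
          ι s₂ - ι s₁ * α      ≈⟨ expand s₁ s₂ ⟩
          _                    ≈⟨ solve 6 (λ r₁ s₁ r₂ s₂ e₁ e₂ →
                                    s₂ :* (r₁ :* e₁ :+ s₁ :* e₂) :- s₁ :* (r₂ :* e₁ :+ s₂ :* e₂)
                                    := (r₁ :* s₂ :- r₂ :* s₁) :* e₁) refl
                                    (ι r₁) (ι s₁) (ι r₂) (ι s₂) e₁ e₂ ⟩
          (ι r₁ * ι s₂ - ι r₂ * ι s₁) * e₁   ≈⟨ *-congʳ ιδ≈0 ⟩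
          0# * e₁                            ≈⟨ zeroˡ e₁ ⟩
          0#                                 ∎)
        r₁≡0 = degenerate δ≡0 r₁ r₂ (begin
          ι r₂ - ι r₁ * α      ≈⟨ expand r₁ r₂ ⟩
          _                    ≈⟨ solve 6 (λ r₁ s₁ r₂ s₂ e₁ e₂ →
                                    r₂ :* (r₁ :* e₁ :+ s₁ :* e₂) :- r₁ :* (r₂ :* e₁ :+ s₂ :* e₂)
                                    := (r₁ :* s₂ :- r₂ :* s₁) :* (:- e₂)) refl
                                    (ι r₁) (ι s₁) (ι r₂) (ι s₂) e₁ e₂ ⟩
          (ι r₁ * ι s₂ - ι r₂ * ι s₁) * - e₂   ≈⟨ *-congʳ ιδ≈0 ⟩
          0# * - e₂                            ≈⟨ zeroˡ (- e₂) ⟩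
          0#                                   ∎)

      instance
        δ-nonZero : NonZero δ
        δ-nonZero = ℚ.≢-nonZero δ≢0

      A = det r₃ s₃ r₂ s₂
      B = det r₁ s₁ r₃ s₃

      δα² : ι δ * (α * α) ≈ ι A + ι B * α
      δα² = begin
        ι δ * (α * α)      ≈⟨ *-cong (ι-det r₁ s₁ r₂ s₂) eq₃ ⟩
        (ι r₁ * ι s₂ - ι r₂ * ι s₁) * (ι r₃ * e₁ + ι s₃ * e₂)
          ≈⟨ solve 8 (λ r₁ s₁ r₂ s₂ r₃ s₃ e₁ e₂ →
               (r₁ :* s₂ :- r₂ :* s₁) :* (r₃ :* e₁ :+ s₃ :* e₂)
               := (r₃ :* s₂ :- r₂ :* s₃) :* (r₁ :* e₁ :+ s₁ :* e₂)
                  :+ (r₁ :* s₃ :- r₃ :* s₁) :* (r₂ :* e₁ :+ s₂ :* e₂)) refl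
               (ι r₁) (ι s₁) (ι r₂) (ι s₂) (ι r₃) (ι s₃) e₁ e₂ ⟩
        (ι r₃ * ι s₂ - ι r₂ * ι s₃) * (ι r₁ * e₁ + ι s₁ * e₂)
          + (ι r₁ * ι s₃ - ι r₃ * ι s₁) * (ι r₂ * e₁ + ι s₂ * e₂)
          ≈⟨ +-cong (*-cong (ι-det r₃ s₃ r₂ s₂) eq₁) (*-cong (ι-det r₁ s₁ r₃ s₃) eq₂) ⟨
        ι A * 1# + ι B * α ≈⟨ +-congʳ (*-identityʳ (ι A)) ⟩
        ι A + ι B * α      ∎

      cramer : ∃₂ λ t ν → α * (ι t - α) ≈ ι ν
      -- From δ α² = A + B α the trace is B / δ and the norm is - A / δ.
      cramer = B ÷ δ , (ℚ.- A) ÷ δ , ι-solve δ (begin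
        ι (ℚ.- A)                          ≈⟨ ι-neg A ⟩
        - ι A                              ≈⟨ solve 3 (λ a b x → :- a := b :* x :- (a :+ b :* x)) refl (ι A) (ι B) α ⟩
        ι B * α - (ι A + ι B * α)          ≈⟨ +-congˡ (-‿cong δα²) ⟨
        ι B * α - ι δ * (α * α)            ≈⟨ +-congʳ (*-congʳ δt≈B) ⟨
        ι δ * ι (B ÷ δ) * α - ι δ * (α * α)
          ≈⟨ solve 3 (λ d t x → d :* t :* x :- d :* (x :* x) := d :* (x :* (t :- x))) refl (ι δ) (ι (B ÷ δ)) α ⟩
        ι δ * (α * (ι (B ÷ δ) - α))        ∎)
        where
        δt≈B : ι δ * ι (B ÷ δ) ≈ ι B
        δt≈B = trans (sym (ι-* δ (B ÷ δ))) (ι-cong (≡.trans (swap δ B (ℚ.1/ δ))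
          (≡.trans (cong (B ℚ.*_) (ℚ.*-inverseʳ δ)) (ℚ.*-identityʳ B))))
          where
          swap : ∀ d b i → d ℚ.* (b ℚ.* i) ≡ b ℚ.* (d ℚ.* i)
          swap = solve-∀ ℚ-ring

  -- Real absolute values of elements of K.

  module RealBounds (σ : Carrier → ℝ) (σ-mono : RealEmbedding K σ) where
    private module σ = RingMorphisms.IsRingMonomorphism σ-mono

    private
      S : Carrier → ℕ → ℚ
      S x = seq (σ x)

      S-cong : ∀ {x y} → x ≈ y → S x ≐ S y
      S-cong {x} {y} e = ≈⇒≐ (σ x) (σ y) (σ.⟦⟧-cong e)

      S-+ : ∀ x y → S (x + y) ≐ λ n → S x n ℚ.+ S y n
      S-+ x y = ≈⇒≐ (σ (x + y)) (σ x +ᴿ σ y) (σ.+-homo x y)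

      S-* : ∀ x y → S (x * y) ≐ λ n → S x n ℚ.* S y n
      S-* x y = ≈⇒≐ (σ (x * y)) (σ x *ᴿ σ y) (σ.*-homo x y)

      S-neg : ∀ x → S (- x) ≐ λ n → ℚ.- S x n
      S-neg x = ≈⇒≐ (σ (- x)) (-ᴿ σ x) (σ.-‿homo x)

      S-fromInt : ∀ i → S (ι (fromInt i)) ≐ λ _ → fromInt i
      S-fromInt = ℤ-induction (λ i → S (ι (fromInt i)) ≐ λ _ → fromInt i)
        (≐-trans _ _ _ (S-cong ι-0) (≈⇒≐ (σ 0#) (fromℚ 0ℚ) σ.0#-homo))
        (λ i h → subst (λ q → S (ι q) ≐ λ _ → q) (≡.sym (fromInt-+ 1ℤ i))
          (≐-trans _ _ _ (S-cong (ι-+ 1ℚ (fromInt i))) (≐-trans _ _ _ (S-+ (ι 1ℚ) (ι (fromInt i)))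
            (≐-+ (S (ι 1ℚ)) (λ _ → 1ℚ) (S (ι (fromInt i))) (λ _ → fromInt i) S-ι1 h))))
        (λ i h → subst (λ q → S (ι q) ≐ λ _ → q) (≡.sym (fromInt-neg i))
          (≐-trans _ _ _ (S-cong (ι-neg (fromInt i))) (≐-trans _ _ _ (S-neg (ι (fromInt i)))
            (≐-neg (S (ι (fromInt i))) (λ _ → fromInt i) h))))
        where
        S-ι1 : S (ι 1ℚ) ≐ λ _ → 1ℚ
        S-ι1 = ≐-trans _ _ _ (S-cong ι-1) (≈⇒≐ (σ 1#) (fromℚ 1ℚ) σ.1#-homo)

    -- A homomorphism is fixed on ℤ by its value at 1, and on r by cancelling the denominator d from
    -- σ (d) σ (r) = σ (d r). Replacing σ (d) by d inside the product requires some bound on σ (r).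
    σ-ι : ∀ r → seq (σ (ι r)) ≐ λ _ → r
    σ-ι r = let T , 0≤T , h = AbsBound-exists (σ (ι r)) in
      ≐-cancel d {{d≢0}} (S (ι r)) r
        (≐-trans _ _ _ (≐-*ʳ (S (ι r)) (λ _ → d) (S (ι d)) 0≤T h (≐-sym _ _ (S-fromInt (ℚ.↧ r))))
          (≐-trans _ _ _ (≐-sym _ _ (S-* (ι d) (ι r)))
            (≐-trans _ _ _ (S-cong (sym (ι-* d r)))
              (subst (λ q → S (ι q) ≐ λ _ → q) (≡.sym (fromInt-↧-* r)) (S-fromInt (ℚ.↥ r))))))
      where
      d = fromInt (ℚ.↧ r)
      d≢0 : NonZero d
      d≢0 = ℚ.≢-nonZero λ e → contradiction (fromInt-injective {ℚ.↧ r} {0ℤ} e) λ ()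

    record Bound (x : Carrier) (r : ℚ) : Set c where
      constructor bound
      field
        bound-σ : AbsBound (seq (σ x)) r

    open Bound public

    bound-cong : ∀ {x y r} → x ≈ y → Bound x r → Bound y r
    bound-cong {x} {y} e (bound h) = bound (AbsBound-resp (S y) (S x) (S-cong (sym e)) h)

    bound-+ : ∀ {x y r s} → Bound x r → Bound y s → Bound (x + y) (r ℚ.+ s)
    bound-+ {x} {y} (bound h) (bound k) =
      bound (AbsBound-resp (S (x + y)) _ (S-+ x y) (AbsBound-+ (S x) (S y) h k))

    bound-* : ∀ {x y r s} → 0ℚ ℚ.≤ r → 0ℚ ℚ.≤ s → Bound x r → Bound y s → Bound (x * y) (r ℚ.* s)
    bound-* {x} {y} 0≤r 0≤s (bound h) (bound k) =
      bound (AbsBound-resp (S (x * y)) _ (S-* x y) (AbsBound-* (S x) (S y) 0≤r 0≤s h k))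

    bound-neg : ∀ {x r} → Bound x r → Bound (- x) r
    bound-neg {x} (bound h) = bound (AbsBound-resp (S (- x)) _ (S-neg x) (AbsBound-neg (S x) h))

    bound-ι : ∀ r → Bound (ι r) ∣ r ∣
    bound-ι r = bound (AbsBound-resp (S (ι r)) (λ _ → r) (σ-ι r) (AbsBound-fromℚ r))

    bound-ι⁻¹ : ∀ {r s} → Bound (ι r) s → ∣ r ∣ ℚ.≤ s
    bound-ι⁻¹ {r} (bound h) =
      AbsBound-fromℚ⁻¹ (AbsBound-resp (λ _ → r) (S (ι r)) (≐-sym _ _ (σ-ι r)) h)

    bound-1 : Bound 1# 1ℚ
    bound-1 = bound-cong ι-1 (bound-ι 1ℚ)

    bound-exists : ∀ x → ∃ λ T → 0ℚ ℚ.≤ T × Bound x T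
    bound-exists x = let T , 0≤T , h = AbsBound-exists (σ x) in T , 0≤T , bound h

    σ-minus-ι : ∀ x r → seq (σ (x - ι r)) ≐ λ n → seq (σ x) n ℚ.- r
    σ-minus-ι x r = ≐-trans _ _ _ (S-+ x (- ι r)) (≐-+ (S x) (S x) (S (- ι r)) (λ _ → ℚ.- r)
      (≐-ext (S x) (S x) λ _ → ≡.refl)
      (≐-trans _ _ _ (S-neg (ι r)) (≐-neg (S (ι r)) (λ _ → r) (σ-ι r))))

  -- 2-adic residues of elements of K.

  module Residues (σ : Carrier → ℚ₂) (σ-mono : 2-AdicEmbedding K σ) where
    private module σ = RingMorphisms.IsRingMonomorphism σ-mono

    infix 4 _≋_[2^_]

    record _≋_[2^_] (x : Carrier) (z : ℤ) (N : ℕ) : Set c where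
      constructor residue
      field
        σ-residue : σ x ≡₂ z [ N ]

    open _≋_[2^_] public

    mod-cong : ∀ {x y z N} → x ≈ y → x ≋ z [2^ N ] → y ≋ z [2^ N ]
    mod-cong {x} {y} {z} {N} e (residue h) = residue (≡₂-cong (σ x) (σ y) {z} {N} (σ.⟦⟧-cong e) h)

    mod-+ : ∀ {x y z w N} → x ≋ z [2^ N ] → y ≋ w [2^ N ] → x + y ≋ z ℤ.+ w [2^ N ]
    mod-+ {x} {y} {z} {w} {N} (residue h) (residue k) = residue
      (≡₂-cong (σ x Q₂.+ σ y) (σ (x + y)) {z ℤ.+ w} {N}
        (≈-sym (σ (x + y)) (σ x Q₂.+ σ y) (σ.+-homo x y)) (≡₂-+ (σ x) (σ y) {z} {w} {N} h k))

    mod-* : ∀ {x y z w N} → x ≋ z [2^ N ] → y ≋ w [2^ N ] → x * y ≋ z ℤ.* w [2^ N ]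
    mod-* {x} {y} {z} {w} {N} (residue h) (residue k) = residue
      (≡₂-cong (σ x Q₂.* σ y) (σ (x * y)) {z ℤ.* w} {N}
        (≈-sym (σ (x * y)) (σ x Q₂.* σ y) (σ.*-homo x y)) (≡₂-* (σ x) (σ y) {z} {w} {N} h k))

    mod-neg : ∀ {x z N} → x ≋ z [2^ N ] → - x ≋ ℤ.- z [2^ N ]
    mod-neg {x} {z} {N} (residue h) = residue
      (≡₂-cong (Q₂.- σ x) (σ (- x)) {ℤ.- z} {N}
        (≈-sym (σ (- x)) (Q₂.- σ x) (σ.-‿homo x)) (≡₂-neg (σ x) {z} {N} h))

    mod-minus : ∀ {x y z w N} → x ≋ z [2^ N ] → y ≋ w [2^ N ] → x - y ≋ z ℤ.- w [2^ N ]
    mod-minus h k = mod-+ h (mod-neg k)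

    mod-0 : ∀ N → 0# ≋ 0ℤ [2^ N ]
    mod-0 N = residue (≡₂-cong Q₂.0# (σ 0#) {0ℤ} {N} (≈-sym (σ 0#) Q₂.0# σ.0#-homo) (≡₂-0 N))

    mod-1 : ∀ N → 1# ≋ 1ℤ [2^ N ]
    mod-1 N = residue (≡₂-cong Q₂.1# (σ 1#) {1ℤ} {N} (≈-sym (σ 1#) Q₂.1# σ.1#-homo) (≡₂-1 N))

    mod-shift : ∀ {x z w N} → 2^ N ∣ℤ z ℤ.- w → x ≋ z [2^ N ] → x ≋ w [2^ N ]
    mod-shift {x} {z} {w} {N} d (residue h) = residue (≡₂-shift (σ x) {z} {w} {N} d h)

    mod-unique : ∀ {x z w N} → x ≋ z [2^ N ] → x ≋ w [2^ N ] → 2^ N ∣ℤ z ℤ.- w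
    mod-unique {x} {z} {w} {N} (residue h) (residue k) = ≡₂-unique (σ x) {z} {w} {N} h k

    mod-weaken : ∀ {x z N M} → N ℕ.≤ M → x ≋ z [2^ M ] → x ≋ z [2^ N ]
    mod-weaken {x} {z} {N} {M} le (residue h) = residue (≡₂-weaken (σ x) {z} {N} {M} le h)

    mod-refine : ∀ {x z N} M → x ≋ z [2^ N ] → ∃ λ w → x ≋ w [2^ M ]
    mod-refine {x} {z} {N} M (residue h) =
      let w , k = ≡₂-refine (σ x) {z} {N} M h in w , residue k

    mod-ι : ∀ i N → ι (fromInt i) ≋ i [2^ N ]
    mod-ι i N = ℤ-induction (λ i → ι (fromInt i) ≋ i [2^ N ])
      (mod-cong (sym ι-0) (mod-0 N))
      (λ i h → mod-cong (sym (trans (ι-cong (fromInt-+ 1ℤ i)) (ι-+ 1ℚ (fromInt i))))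
        (mod-+ (mod-cong (sym ι-1) (mod-1 N)) h))
      (λ i h → mod-cong (sym (trans (ι-cong (fromInt-neg i)) (ι-neg (fromInt i)))) (mod-neg h))
      i

    private
      σι2^ : ∀ k M → σ (ι (fromInt (2^ k))) ≡₂ 2^ k [ M ]
      σι2^ k M = σ-residue (mod-ι (2^ k) M)

      σ-*-≈ : ∀ x y → σ x Q₂.* σ y Q₂.≈ σ (x * y)
      σ-*-≈ x y = ≈-sym (σ (x * y)) (σ x Q₂.* σ y) (σ.*-homo x y)

    mod-2^* : ∀ k {x z N} → x ≋ z [2^ N ] → ι (fromInt (2^ k)) * x ≋ 2^ k ℤ.* z [2^ k ℕ.+ N ]
    mod-2^* k {x} {z} {N} (residue h) = residue
      (≡₂-cong (σ D Q₂.* σ x) (σ (D * x)) {2^ k ℤ.* z} {k ℕ.+ N} (σ-*-≈ D x)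
        (2^-multiple (σ D) k (σι2^ k) (σ x) {z} {N} h))
      where D = ι (fromInt (2^ k))

    mod-2^-cancel : ∀ k {x z N} →
      ι (fromInt (2^ k)) * x ≋ 2^ k ℤ.* z [2^ k ℕ.+ N ] → x ≋ z [2^ N ]
    mod-2^-cancel k {x} {z} {N} (residue h) = residue
      (2^-cancel (σ D) k (σι2^ k) (σ x) {z} {N}
        (≡₂-cong (σ (D * x)) (σ D Q₂.* σ x) {2^ k ℤ.* z} {k ℕ.+ N} (σ.*-homo D x) h))
      where D = ι (fromInt (2^ k))

    -- The hypotheses say that a has the digits of σ x below 2ᴺ.
    mod-truncate : ∀ {x N a i} → let k = ℚ₂.exp (σ x) in
      fromInt (2^ k) ℚ.* a ≡ fromInt i → 2^ (k ℕ.+ N) ∣ℤ res (ℚ₂.num (σ x)) (k ℕ.+ N) ℤ.- i →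
      x - ι a ≋ 0ℤ [2^ N ]
    mod-truncate {x} {N} {a} {i} 2ᵏa≡i d = mod-2^-cancel k
      (subst (λ z → D * (x - ι a) ≋ z [2^ M ]) (≡.sym (ℤ.*-zeroʳ (2^ k)))
        (mod-cong Dx-i≈D[x-a] (mod-shift (divides 0ℤ (≡.trans (ℤ.+-identityʳ _) (ℤ.+-inverseʳ i)))
          (mod-minus (mod-shift agree Dx) (mod-ι i M)))))
      where
      k = ℚ₂.exp (σ x)
      X = ℚ₂.num (σ x)
      M = k ℕ.+ N
      D = ι (fromInt (2^ k))
      Dx : D * x ≋ res X (M ℕ.+ k) [2^ M ]
      Dx = residue (≡₂-cong (σ D Q₂.* σ x) (σ (D * x)) {res X (M ℕ.+ k)} {M} (σ-*-≈ D x)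
        (clear-denominator (σ D) k (σι2^ k) X M))
      agree : 2^ M ∣ℤ res X (M ℕ.+ k) ℤ.- i
      agree = subst (2^ M ∣ℤ_)
        (ℤ-solve 3 (λ a b c → (a ⊝ b) ⊕ (b ⊝ c) ⊜ (a ⊝ c)) ≡.refl (res X (M ℕ.+ k)) (res X M) i)
        (∣m∣n⇒∣m+n (coherent-≤ X (ℕ.m≤m+n M k)) d)
      Dx-i≈D[x-a] : D * x - ι (fromInt i) ≈ D * (x - ι a)
      Dx-i≈D[x-a] = trans
        (+-congˡ (-‿cong (trans (ι-cong (≡.sym 2ᵏa≡i)) (ι-* (fromInt (2^ k)) a))))
        (solve 3 (λ d x a → d :* x :- d :* a := d :* (x :- a)) refl D x (ι a))

    -- This is ℤ[1/2] ∩ ℤ₂ = ℤ. With 2ᵏ r = j, integrality of r makes j congruent to 2ᵏ z modulo 2ᵏ,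
    -- so 2ᵏ divides j already in ℤ.
    dyadic-integral : ∀ {r z} → Dyadic r → ι r ≋ z [2^ 0 ] → ∃ λ i → r ≡ fromInt i
    dyadic-integral {r} {z} (k , j , 2ᵏr≡j) h = quotient k∣j , *-cancelˡ-≡ d (≡.trans 2ᵏr≡j j≡)
      where
      open Div._∣_
      d = fromInt (2^ k)
      instance
        d≢0 : NonZero d
        d≢0 = ℚ.≢-nonZero λ e →
          contradiction (ℤ.+-injective (fromInt-injective {2^ k} {0ℤ} e)) (ℕ.≢-nonZero⁻¹ _ {{ℕ.m^n≢0 2 k}})
      2ᵏr≋j : ι d * ι r ≋ j [2^ k ℕ.+ 0 ]
      2ᵏr≋j = mod-cong (trans (ι-cong (≡.sym 2ᵏr≡j)) (ι-* d r)) (mod-ι j (k ℕ.+ 0))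
      k∣j : 2^ k ∣ℤ j
      k∣j = subst (2^ k ∣ℤ_)
        (ℤ-solve 2 (λ t j → t ⊝ (t ⊝ j) ⊜ j) ≡.refl (2^ k ℤ.* z) j)
        (∣m∣n⇒∣m-n (∣m⇒∣m*n z Div.∣-refl)
          (2^-resp-∣ (ℕ.+-identityʳ k) (mod-unique (mod-2^* k h) 2ᵏr≋j)))
      j≡ : fromInt j ≡ d ℚ.* fromInt (quotient k∣j)
      j≡ = ≡.trans (cong fromInt (≡.trans (equality k∣j) (ℤ.*-comm (quotient k∣j) (2^ k))))
        (fromInt-* (2^ k) (quotient k∣j))

    -- All integers are congruent modulo 2⁰, so this is membership in ℤ₂.
    Integral : Carrier → Set _
    Integral x = x ≋ 0ℤ [2^ 0 ]

    integral : ∀ {x} z → x ≋ z [2^ 0 ] → Integral x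
    integral z = mod-shift (divides z (≡.trans (ℤ.+-identityʳ z) (≡.sym (ℤ.*-identityʳ z))))

  -- A single step of the algorithm, in ℝ and in ℚ₂.

  module Embedded (σ∞ : Carrier → ℝ) (σ∞-mono : RealEmbedding K σ∞)
                  (σ₂ : Carrier → ℚ₂) (σ₂-mono : 2-AdicEmbedding K σ₂) where
    open RealBounds σ∞ σ∞-mono
    open Residues σ₂ σ₂-mono
    open Algorithm K σ∞ σ₂

    2^level∣stride : ∀ ε m → 2^ level ε ∣ℤ stride ε ℤ.* m
    2^level∣stride 0ℙ m = ∣m⇒∣m*n m Div.∣-refl
    2^level∣stride 1ℙ m = ∣m⇒∣m*n m Div.∣-refl

    level≤1 : ∀ ε → level ε ℕ.≤ 1
    level≤1 0ℙ = ℕ.≤-refl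
    level≤1 1ℙ = ℕ.z≤n

    radius+radius : ∀ ε → radius ε ℚ.+ radius ε ≡ fromInt (stride ε)
    radius+radius 0ℙ = ≡.refl
    radius+radius 1ℙ = ≡.refl

    module _ {ε α a α′} (st : Step ε α a α′) where
      open Step st

      -- Removing the digits up to position 0 leaves a multiple of 2, and the integer part then
      -- removed is a multiple of the stride: even when `level ε` is 1, arbitrary when it is 0.
      step-residue : α′ ≋ 0ℤ [2^ level ε ]
      step-residue = mod-cong (sym α′-def) (mod-truncate scaled close)
        where
        k = ℚ₂.exp (σ₂ recip)
        X = ℚ₂.num (σ₂ recip)
        N = level ε
        s = digitSum X (suc k)
        i = 2^ k ℤ.* (stride ε ℤ.* m) ℤ.+ + s
        -- The numerator loses its k + 1 lowest digits: k of them make the quotient integral, and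
        -- the last one makes it even.
        k+N≤1+k : k ℕ.+ N ℕ.≤ suc k
        k+N≤1+k = subst (k ℕ.+ N ℕ.≤_) (ℕ.+-comm k 1) (ℕ.+-monoʳ-≤ k (level≤1 ε))
        scaled : fromInt (2^ k) ℚ.* a ≡ fromInt i
        scaled = ≡.trans (cong (λ t → fromInt (2^ k) ℚ.* t) a-def)
          (≡.trans (ℚ.*-distribˡ-+ (fromInt (2^ k)) (fromInt (stride ε ℤ.* m)) ⌊recip⌋)
            (≡.trans (cong₂ ℚ._+_ (≡.sym (fromInt-* (2^ k) (stride ε ℤ.* m)))
                                  (fromInt-*-/ (+ s) (2 ℕ.^ k) {{ℕ.m^n≢0 2 k}}))
              (≡.sym (fromInt-+ (2^ k ℤ.* (stride ε ℤ.* m)) (+ s)))))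
        close : 2^ (k ℕ.+ N) ∣ℤ res X (k ℕ.+ N) ℤ.- i
        close = subst (2^ (k ℕ.+ N) ∣ℤ_)
          (ℤ-solve 4 (λ a b s t → ((b ⊝ s) ⊝ (b ⊝ a)) ⊝ t ⊜ a ⊝ (t ⊕ s)) ≡.refl
            (res X (k ℕ.+ N)) (res X (suc k)) (+ s) (2^ k ℤ.* (stride ε ℤ.* m)))
          (∣m∣n⇒∣m-n
            (∣m∣n⇒∣m-n (Div.∣-trans (2^-mono-∣ k+N≤1+k) (digitSum-∣ X (suc k))) (coherent-≤ X k+N≤1+k))
            (2^-*-∣ k N (2^level∣stride ε m)))

      -- Moving m by one moves the offset by the stride, which is twice the radius; so m - 1 and m +
      -- 1 give the two lattice neighbours.
      step-bound : Bound α′ (radius ε)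
      step-bound = bound-cong (sym α′-def) (bound (AbsBound-resp _ _ (σ-minus-ι recip a)
        (AbsBound-ext (seq (offset m)) _ (λ n → ≡.trans (regroup (seq (σ∞ recip) n) F ⌊recip⌋)
            (cong (λ t → seq (σ∞ recip) n ℚ.- t) (≡.sym a-def)))
          (∣∣≤∣±2h∣⇒AbsBound (radius ε) (offset m) (offset (m ℤ.+ 1ℤ)) (offset (m ℤ.- 1ℤ)) (0<radius ε)
            (λ n → ≡.trans (cong (λ t → seq (σ∞ recip) n ℚ.- t ℚ.- ⌊recip⌋) next)
              (regroup₊ (seq (σ∞ recip) n) F ⌊recip⌋ (radius ε ℚ.+ radius ε)))
            (λ n → ≡.trans (cong (λ t → seq (σ∞ recip) n ℚ.- t ℚ.- ⌊recip⌋) prev)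
              (regroup₋ (seq (σ∞ recip) n) F ⌊recip⌋ (radius ε ℚ.+ radius ε)))
            (proj₁ m-smallest (m ℤ.+ 1ℤ)) (proj₁ m-smallest (m ℤ.- 1ℤ))))))
        where
        offset : ℤ → ℝ
        offset i = σ∞ recip -ᴿ fromℚ (fromInt (stride ε ℤ.* i)) -ᴿ fromℚ ⌊recip⌋
        F = fromInt (stride ε ℤ.* m)
        0<radius : ∀ ε → 0ℚ ℚ.< radius ε
        0<radius 0ℙ = ℚ.positive⁻¹ 1ℚ
        0<radius 1ℙ = ℚ.positive⁻¹ ½
        next : fromInt (stride ε ℤ.* (m ℤ.+ 1ℤ)) ≡ F ℚ.+ (radius ε ℚ.+ radius ε)
        next = ≡.trans (cong fromInt (≡.trans (ℤ.*-distribˡ-+ (stride ε) m 1ℤ)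
            (cong (λ t → stride ε ℤ.* m ℤ.+ t) (ℤ.*-identityʳ (stride ε)))))
          (≡.trans (fromInt-+ (stride ε ℤ.* m) (stride ε)) (cong (λ t → F ℚ.+ t) (≡.sym (radius+radius ε))))
        prev : fromInt (stride ε ℤ.* (m ℤ.- 1ℤ)) ≡ F ℚ.- (radius ε ℚ.+ radius ε)
        prev = ≡.trans (cong fromInt (ℤ-solve 2 (λ s m → s ⊛ (m ⊝ con 1ℤ) ⊜ s ⊛ m ⊕ (⊝′ s)) ≡.refl (stride ε) m))
          (≡.trans (fromInt-+ (stride ε ℤ.* m) (ℤ.- stride ε))
            (cong (λ t → F ℚ.+ t) (≡.trans (fromInt-neg (stride ε)) (cong ℚ.-_ (≡.sym (radius+radius ε))))))
          where open Data.Integer.Solver.+-*-Solver using (con) renaming (_:*_ to _⊛_; :-_ to ⊝′_)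
        regroup : ∀ x f l → x ℚ.- f ℚ.- l ≡ x ℚ.- (f ℚ.+ l)
        regroup = solve-∀ ℚ-ring
        regroup₊ : ∀ x f l r → x ℚ.- (f ℚ.+ r) ℚ.- l ≡ x ℚ.- f ℚ.- l ℚ.- r
        regroup₊ = solve-∀ ℚ-ring
        regroup₋ : ∀ x f l r → x ℚ.- (f ℚ.- r) ℚ.- l ≡ x ℚ.- f ℚ.- l ℚ.+ r
        regroup₋ = solve-∀ ℚ-ring

      step-dyadic : Dyadic a
      step-dyadic = subst Dyadic (≡.sym a-def)
        (Dyadic-+ (Dyadic-fromInt (stride ε ℤ.* m)) (Dyadic-⌊⌋₂ (σ₂ recip)))

      -- Trades the partial quotient, which may have a denominator, for two quotients that are
      -- 2-adic integers.
      step-equation : α * ι a ≈ 1# - α * α′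
      step-equation = begin
        α * ι a                              ≈⟨ solve 3 (λ x r a → x :* a := x :* r :- x :* (r :- a)) refl α recip (ι a) ⟩
        α * recip - α * (recip - ι a)        ≈⟨ +-cong α*recip≈1 (-‿cong (*-congˡ (sym α′-def))) ⟩
        1# - α * α′                          ∎

    -- The norm bound for one approximation p / q.

    module Approximation {α : Carrier} (α∉ℚ : ¬ IsRational α) (α-integral : Integral α)
                         {t ν : ℚ} (α[t-α]≈ν : α * (ι t - α) ≈ ι ν)
                         {T : ℚ} (0≤T : 0ℚ ℚ.≤ T) (T-bound : Bound (ι t - (α + α)) T)
                         {C : ℚ} (C≢0 : ¬ C ≡ 0ℚ) {d i j : ℤ} (C≡d : C ≡ fromInt d)
                         (Ct≡i : C ℚ.* t ≡ fromInt i) (Cν≡j : C ℚ.* ν ≡ fromInt j) where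

      -- The norm of q α - p from K to ℚ; its other conjugate is q (t - α) - p.
      norm : ℚ → ℚ → ℚ
      norm p q = q ℚ.* q ℚ.* ν ℚ.- q ℚ.* p ℚ.* t ℚ.+ p ℚ.* p

      ι-norm : ∀ p q → (ι q * α - ι p) * (ι q * (ι t - α) - ι p) ≈ ι (norm p q)
      ι-norm p q = begin
        (ι q * α - ι p) * (ι q * (ι t - α) - ι p)
          ≈⟨ solve 4 (λ x t q p → (q :* x :- p) :* (q :* (t :- x) :- p)
               := q :* q :* (x :* (t :- x)) :- q :* p :* t :+ p :* p) refl α (ι t) (ι q) (ι p) ⟩
        ι q * ι q * (α * (ι t - α)) - ι q * ι p * ι t + ι p * ι p
          ≈⟨ +-congʳ (+-congʳ (*-congˡ α[t-α]≈ν)) ⟩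
        ι q * ι q * ι ν - ι q * ι p * ι t + ι p * ι p
          ≈⟨ +-cong (+-cong (ι-*₃ q q ν) (-‿cong (ι-*₃ q p t))) (ι-* p p) ⟨
        ι (q ℚ.* q ℚ.* ν) - ι (q ℚ.* p ℚ.* t) + ι (p ℚ.* p)
          ≈⟨ trans (ι-+ _ _) (+-congʳ (ι-minus _ _)) ⟨
        ι (norm p q) ∎
        where
        ι-*₃ : ∀ x y z → ι (x ℚ.* y ℚ.* z) ≈ ι x * ι y * ι z
        ι-*₃ x y z = trans (ι-* (x ℚ.* y) z) (*-congʳ (ι-* x y))

      -- If the norm vanishes, so does one of its factors, and α would equal p / q or t - p / q.
      -- Equality in K is not assumed decidable, hence the double negation in place of a case
      -- distinction.
      norm≢0 : ∀ p q .{{_ : NonZero q}} → ¬ norm p q ≡ 0ℚ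
      norm≢0 p q norm≡0 = β≉0 λ β≈0 → α∉ℚ (p ÷ q , ι-solve q (x-y≈0⇒y≈x β≈0))
        where
        x-y≈0⇒y≈x : ∀ {x y} → x - y ≈ 0# → y ≈ x
        x-y≈0⇒y≈x {x} {y} e = begin
          y               ≈⟨ solve 2 (λ x y → y := x :- (x :- y)) refl x y ⟩
          x - (x - y)     ≈⟨ +-congˡ (trans (-‿cong e) (trans (-‿cong (sym ι-0)) (trans (sym (ι-neg 0ℚ)) ι-0))) ⟩
          x + 0#          ≈⟨ +-identityʳ x ⟩
          x               ∎
        β≉0 : ¬ ¬ (ι q * α - ι p ≈ 0#)
        β≉0 β≉0 = α∉ℚ (t ℚ.- p ÷ q , (begin
          α                        ≈⟨ solve 2 (λ x t → x := t :- (t :- x)) refl α (ι t) ⟩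
          ι t - (ι t - α)          ≈⟨ +-congˡ (-‿cong (ι-solve q (x-y≈0⇒y≈x β′≈0))) ⟩
          ι t - ι (p ÷ q)          ≈⟨ ι-minus t (p ÷ q) ⟨
          ι (t ℚ.- p ÷ q)          ∎))
          where
          β′≈0 : ι q * (ι t - α) - ι p ≈ 0#
          β′≈0 = x*y≈0⇒y≈0 β≉0 (trans (ι-norm p q) (trans (ι-cong norm≡0) ι-0))

      module _ (p q : ℚ) {{q≢0 : NonZero q}} (p-dyadic : Dyadic p) (q-dyadic : Dyadic q)
               (p-integral : Integral ((ι q * α - ι p) * ι p))
               (q-integral : Integral ((ι q * α - ι p) * ι q))
               {b : ℚ} (0≤b : 0ℚ ℚ.≤ b) (b≤1 : b ℚ.≤ 1ℚ) (b-bound : Bound (ι q * α - ι p) b) where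

        private
          N = norm p q

        -- With g = q α - p, distributing gives C g (q (t - α) - p) = (g q)(C t - C α) - C (g p).
        -- Thus p and q occur only in products with g, and t only in the integer C t.
        Cnorm-integral : Integral (ι (C ℚ.* N))
        Cnorm-integral = mod-cong (sym (begin
          ι (C ℚ.* N)
            ≈⟨ trans (ι-* C N) (*-congˡ (sym (ι-norm p q))) ⟩
          ι C * ((ι q * α - ι p) * (ι q * (ι t - α) - ι p))
            ≈⟨ solve 6 (λ c g q t x p → c :* (g :* (q :* (t :- x) :- p))
                 := g :* q :* (c :* t :- c :* x) :- c :* (g :* p)) refl
                 (ι C) (ι q * α - ι p) (ι q) (ι t) α (ι p) ⟩
          (ι q * α - ι p) * ι q * (ι C * ι t - ι C * α) - ι C * ((ι q * α - ι p) * ι p)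
            ≈⟨ +-congʳ (*-congˡ (+-congʳ (trans (sym (ι-* C t)) (ι-cong Ct≡i)))) ⟩
          (ι q * α - ι p) * ι q * (ι (fromInt i) - ι C * α) - ι C * ((ι q * α - ι p) * ι p) ∎))
          (mod-minus
            (integral _ (mod-* q-integral (mod-minus (mod-ι i 0) (mod-* C-residue α-integral))))
            (integral _ (mod-* C-residue p-integral)))
          where
          C-residue : ι C ≋ d [2^ 0 ]
          C-residue = mod-cong (ι-cong (≡.sym C≡d)) (mod-ι d 0)

        Cnorm-dyadic : Dyadic (C ℚ.* N)
        Cnorm-dyadic = subst Dyadic (regroup C q p t ν)
          (Dyadic-+ (Dyadic-+
            (Dyadic-* (Dyadic-* q-dyadic q-dyadic) (subst Dyadic (≡.sym Cν≡j) (Dyadic-fromInt j)))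
            (Dyadic-neg (Dyadic-* (Dyadic-* q-dyadic p-dyadic)
              (subst Dyadic (≡.sym Ct≡i) (Dyadic-fromInt i)))))
            (Dyadic-* (subst Dyadic (≡.sym C≡d) (Dyadic-fromInt d)) (Dyadic-* p-dyadic p-dyadic)))
          where
          regroup : ∀ C q p t ν → q ℚ.* q ℚ.* (C ℚ.* ν) ℚ.- q ℚ.* p ℚ.* (C ℚ.* t) ℚ.+ C ℚ.* (p ℚ.* p)
            ≡ C ℚ.* (q ℚ.* q ℚ.* ν ℚ.- q ℚ.* p ℚ.* t ℚ.+ p ℚ.* p)
          regroup = solve-∀ ℚ-ring

        1≤∣Cnorm∣ : 1ℚ ℚ.≤ ∣ C ℚ.* N ∣
        1≤∣Cnorm∣ = nonZero-integer (dyadic-integral Cnorm-dyadic Cnorm-integral)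
          (*-≢0 C≢0 (norm≢0 p q))

        -- The conjugate factor is controlled by its distance from the small one: q (t - α) - p = q
        -- (t - 2α) + (q α - p).
        ∣Cnorm∣≤ : ∣ C ℚ.* N ∣ ℚ.≤ ∣ C ∣ ℚ.* (b ℚ.* (∣ q ∣ ℚ.* T ℚ.+ b))
        ∣Cnorm∣≤ = bound-ι⁻¹ (bound-cong
          (begin
            ι C * ((ι q * α - ι p) * (ι q * (ι t - (α + α)) + (ι q * α - ι p)))
              ≈⟨ *-congˡ (*-congˡ (solve 4 (λ q t x p → q :* (t :- (x :+ x)) :+ (q :* x :- p)
                   := q :* (t :- x) :- p) refl (ι q) (ι t) α (ι p))) ⟩
            ι C * ((ι q * α - ι p) * (ι q * (ι t - α) - ι p))
              ≈⟨ *-congˡ (ι-norm p q) ⟩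
            ι C * ι N
              ≈⟨ ι-* C N ⟨
            ι (C ℚ.* N) ∎)
          (bound-* (ℚ.0≤∣p∣ C) (0≤* 0≤b 0≤qT+b) (bound-ι C)
            (bound-* 0≤b 0≤qT+b b-bound
              (bound-+ (bound-* (ℚ.0≤∣p∣ q) 0≤T (bound-ι q) T-bound) b-bound))))
          where
          0≤qT+b : 0ℚ ℚ.≤ ∣ q ∣ ℚ.* T ℚ.+ b
          0≤qT+b = ℚ.+-mono-≤ (0≤* (ℚ.0≤∣p∣ q) 0≤T) 0≤b

        quotient-bound : AbsBound (λ k → p ÷ q ℚ.- seq (σ∞ α) k) (∣ ℚ.1/ q ∣ ℚ.* b)
        quotient-bound = AbsBound-ext (λ k → ℚ.- (seq (σ∞ α) k ℚ.- p ÷ q)) _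
          (λ k → swap (seq (σ∞ α) k) (p ÷ q))
          (AbsBound-neg _ (AbsBound-resp _ _ (≐-sym _ _ (σ-minus-ι α (p ÷ q))) (bound-σ (bound-cong
            (begin
              ι (ℚ.1/ q) * (ι q * α - ι p)
                ≈⟨ solve 4 (λ i q x p → i :* (q :* x :- p) := i :* q :* x :- p :* i) refl
                     (ι (ℚ.1/ q)) (ι q) α (ι p) ⟩
              ι (ℚ.1/ q) * ι q * α - ι p * ι (ℚ.1/ q)
                ≈⟨ +-cong (*-congʳ (trans (sym (ι-* (ℚ.1/ q) q)) (trans (ι-cong (ℚ.*-inverseˡ q)) ι-1)))
                          (-‿cong (sym (ι-* p (ℚ.1/ q)))) ⟩
              1# * α - ι (p ÷ q)
                ≈⟨ +-congʳ (*-identityˡ α) ⟩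
              α - ι (p ÷ q) ∎)
            (bound-* (ℚ.0≤∣p∣ (ℚ.1/ q)) 0≤b (bound-ι (ℚ.1/ q)) b-bound)))))
          where
          swap : ∀ x y → ℚ.- (x ℚ.- y) ≡ y ℚ.- x
          swap = solve-∀ ℚ-ring

        quotient-close : ∀ {ε} → 0ℚ ℚ.< ε → b ℚ.* (∣ C ∣ ℚ.* (T ℚ.+ ε)) ℚ.< ε →
          ∃ λ δ → 0ℚ ℚ.< δ × Eventually λ k → ∣ p ÷ q ℚ.- seq (σ∞ α) k ∣ ℚ.+ δ ℚ.≤ ε
        quotient-close 0<ε small = AbsBound⇒< (1/*-< q (ℚ.≰⇒> (denominator-not-small
          (ℚ.0≤∣p∣ C) 0≤b b≤1 0≤T 0<ε (ℚ.≤-trans 1≤∣Cnorm∣ ∣Cnorm∣≤) small))) quotient-bound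

    -- The infinite expansion and its convergents.

    module Expansion {α : Carrier} (α∈I : PropertyI α) {a : ℕ → ℚ} {αs : ℕ → Carrier}
                     (expansion : IsExpansion α a αs) where
      open PropertyI α∈I
      open IsExpansion expansion renaming (start to α₁≈α)
      open Mat₂ using (m₁₁; m₁₂; m₂₁; m₂₂)

      -- Indexed from 0, so that A n is the quotient reached after n steps.
      A : ℕ → Carrier
      A n = αs (suc n)

      step′ : ∀ n → Step (parity (suc n)) (A n) (a (suc n)) (A (suc n))
      step′ n = step (suc n) (ℕ.s≤s ℕ.z≤n)

      A-residue : ∀ n → A n ≋ 0ℤ [2^ level (parity n) ]
      A-residue (suc n) = step-residue (step′ n)
      -- Property I says of α what an even step says of its result, in agreement with `parity 0`,
      -- whose level is 1.
      A-residue zero = mod-cong (sym α₁≈α) (residue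
        (subst (2^ suc k ∣ℤ_)
          (≡.sym (≡.trans (cong (λ t → X ℤ.- t) (ℤ.*-zeroʳ (2^ k))) (ℤ.+-identityʳ X))) v₂α>0))
        where
        k = ℚ₂.exp (σ₂ α)
        X = res (ℚ₂.num (σ₂ α)) (suc k)

      A-bound : ∀ n → Bound (A n) (radius (parity n))
      A-bound (suc n) = step-bound (step′ n)
      A-bound zero = bound-cong (sym α₁≈α) (bound (∈[-r,r]⇒AbsBound (σ∞ α) -1<α∞ α∞≤1))

      A-integral : ∀ n → A n ≋ 0ℤ [2^ 0 ]
      A-integral n = mod-weaken ℕ.z≤n (A-residue n)

      -- One of two consecutive quotients is even and the other one is integral.
      A-even : ∀ n → A n * A (suc n) ≋ 0ℤ [2^ 1 ]
      A-even n = case (parity n) (parity (suc n)) (alternate n) (A-residue n) (A-residue (suc n))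
        where
        alternate : ∀ n → (parity n ≡ 0ℙ) ⊎ (parity (suc n) ≡ 0ℙ)
        alternate zero          = inj₁ ≡.refl
        alternate (suc zero)    = inj₂ ≡.refl
        alternate (suc (suc n)) = alternate n
        case : ∀ p q {x y} → (p ≡ 0ℙ) ⊎ (q ≡ 0ℙ) →
          x ≋ 0ℤ [2^ level p ] → y ≋ 0ℤ [2^ level q ] → x * y ≋ 0ℤ [2^ 1 ]
        case p q {x} {y} (inj₁ ≡.refl) h k = let w , k′ = mod-refine 1 k in
          subst (λ z → x * y ≋ z [2^ 1 ]) (ℤ.*-zeroˡ w) (mod-* h k′)
        case p q {x} {y} (inj₂ ≡.refl) h k = let w , h′ = mod-refine 1 h in
          subst (λ z → x * y ≋ z [2^ 1 ]) (ℤ.*-zeroʳ w) (mod-* h′ k)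

      -- g n = ± α₍₁₎ ⋯ α₍ₙ₎, with the sign for which g (suc n) = qₙ α - pₙ.
      g : ℕ → Carrier
      g zero    = - 1#
      g (suc n) = - (g n * A n)

      g-bound : ∀ n → Bound (g n) (decay n)
      g-bound zero    = bound-neg bound-1
      g-bound (suc n) = bound-neg (bound-* (0≤decay n) (0≤radius (parity n)) (g-bound n) (A-bound n))

      private
        ι-column₁ : ∀ x y → ι (x ℚ.* 0ℚ ℚ.+ y ℚ.* 1ℚ) ≈ ι y
        ι-column₁ x y = ι-cong (≡.trans (cong₂ ℚ._+_ (ℚ.*-zeroʳ x) (ℚ.*-identityʳ y)) (ℚ.+-identityˡ y))

        ι-column₂ : ∀ x y z → ι (x ℚ.* 1ℚ ℚ.+ y ℚ.* z) ≈ ι x + ι y * ι z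
        ι-column₂ x y z = trans (ι-+ (x ℚ.* 1ℚ) (y ℚ.* z)) (+-cong (ι-cong (ℚ.*-identityʳ x)) (ι-* y z))

        M : ℕ → Mat₂
        M = convergentMatrix a

      -- The step equation gives g (n + 2) = g n + g (n + 1) aₙ₊₁, the recursion of the matrix
      -- columns. Both columns are carried since it has two terms; the first column (1, 0) of the
      -- identity matrix accounts for g 0 = -1.
      g≈qα-p : ∀ n → (g n ≈ ι (m₂₁ (M n)) * α - ι (m₁₁ (M n))) × (g (suc n) ≈ ι (m₂₂ (M n)) * α - ι (m₁₂ (M n)))
      g≈qα-p zero = left , right
        where
        left : - 1# ≈ ι 0ℚ * α - ι 1ℚ
        left = begin
          - 1#                ≈⟨ -‿cong ι-1 ⟨
          - ι 1ℚ              ≈⟨ solve 1 (λ x → :- con 1ℚ := con 0ℚ :* x :- con 1ℚ) refl α ⟩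
          ι 0ℚ * α - ι 1ℚ     ∎
        right : - (- 1# * A 0) ≈ ι 1ℚ * α - ι 0ℚ
        right = begin
          - (- 1# * A 0)      ≈⟨ -‿cong (*-cong (-‿cong (sym ι-1)) α₁≈α) ⟩
          - (- ι 1ℚ * α)      ≈⟨ solve 1 (λ x → :- (:- con 1ℚ :* x) := con 1ℚ :* x :- con 0ℚ) refl α ⟩
          ι 1ℚ * α - ι 0ℚ     ∎
      g≈qα-p (suc n) = left , right
        where
        P′ = m₁₁ (M n)
        P  = m₁₂ (M n)
        Q′ = m₂₁ (M n)
        Q  = m₂₂ (M n)
        aₙ = a (suc n)
        left : g (suc n) ≈ ι (Q′ ℚ.* 0ℚ ℚ.+ Q ℚ.* 1ℚ) * α - ι (P′ ℚ.* 0ℚ ℚ.+ P ℚ.* 1ℚ)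
        left = trans (proj₂ (g≈qα-p n))
          (sym (+-cong (*-congʳ (ι-column₁ Q′ Q)) (-‿cong (ι-column₁ P′ P))))
        right : g (suc (suc n)) ≈ ι (Q′ ℚ.* 1ℚ ℚ.+ Q ℚ.* aₙ) * α - ι (P′ ℚ.* 1ℚ ℚ.+ P ℚ.* aₙ)
        right = begin
          - (- (g n * A n) * A (suc n))
            ≈⟨ solve 3 (λ g x y → :- (:- (g :* x) :* y) := g :* (x :* y)) refl (g n) (A n) (A (suc n)) ⟩
          g n * (A n * A (suc n))
            ≈⟨ *-congˡ (solve 2 (λ o z → z := o :- (o :- z)) refl 1# (A n * A (suc n))) ⟩
          g n * (1# - (1# - A n * A (suc n)))
            ≈⟨ *-congˡ (+-congˡ (-‿cong (step-equation (step′ n)))) ⟨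
          g n * (1# - A n * ι aₙ)
            ≈⟨ trans (solve 4 (λ g o x a → g :* (o :- x :* a) := g :* o :+ (:- (g :* x)) :* a) refl (g n) 1# (A n) (ι aₙ))
                     (+-congʳ (*-identityʳ (g n))) ⟩
          g n + g (suc n) * ι aₙ
            ≈⟨ +-cong (proj₁ (g≈qα-p n)) (*-congʳ (proj₂ (g≈qα-p n))) ⟩
          (ι Q′ * α - ι P′) + (ι Q * α - ι P) * ι aₙ
            ≈⟨ solve 6 (λ q′ p′ q p x a → (q′ :* x :- p′) :+ (q :* x :- p) :* a
                 := (q′ :+ q :* a) :* x :- (p′ :+ p :* a)) refl (ι Q′) (ι P′) (ι Q) (ι P) α (ι aₙ) ⟩
          (ι Q′ + ι Q * ι aₙ) * α - (ι P′ + ι P * ι aₙ)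
            ≈⟨ +-cong (*-congʳ (ι-column₂ Q′ Q aₙ)) (-‿cong (ι-column₂ P′ P aₙ)) ⟨
          ι (Q′ ℚ.* 1ℚ ℚ.+ Q ℚ.* aₙ) * α - ι (P′ ℚ.* 1ℚ ℚ.+ P ℚ.* aₙ) ∎

      g-column₁ : ∀ n x y → g (suc n) * ι (x ℚ.* 0ℚ ℚ.+ y ℚ.* 1ℚ) ≈ - (g n * ι y * A n)
      g-column₁ n x y = trans (*-congˡ (ι-column₁ x y))
        (solve 3 (λ g A y → :- (g :* A) :* y := :- (g :* y :* A)) refl (g n) (A n) (ι y))

      -- Multiplication by g (n + 1) = - g n αₙ₊₁ brings aₙ₊₁ together with αₙ₊₁, and the step
      -- equation removes it. The products with g therefore obey a recursion whose coefficients are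
      -- 2-adic integers.
      g-column₂ : ∀ n x y → g (suc n) * ι (x ℚ.* 1ℚ ℚ.+ y ℚ.* a (suc n)) ≈
        - (g n * ι x * A n + g n * ι y * (1# - A n * A (suc n)))
      g-column₂ n x y = begin
        g (suc n) * ι (x ℚ.* 1ℚ ℚ.+ y ℚ.* a (suc n))
          ≈⟨ *-congˡ (ι-column₂ x y (a (suc n))) ⟩
        g (suc n) * (ι x + ι y * ι (a (suc n)))
          ≈⟨ solve 5 (λ g A x y a → :- (g :* A) :* (x :+ y :* a) := :- (g :* x :* A :+ g :* y :* (A :* a))) refl
               (g n) (A n) (ι x) (ι y) (ι (a (suc n))) ⟩
        - (g n * ι x * A n + g n * ι y * (A n * ι (a (suc n))))
          ≈⟨ -‿cong (+-congˡ (*-congˡ (step-equation (step′ n)))) ⟩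
        - (g n * ι x * A n + g n * ι y * (1# - A n * A (suc n))) ∎

      -- Stated for any row (x, y): the rows of p and q obey the same recursion and differ in their
      -- initial values.
      column-integral : ∀ n x y → Integral (g n * ι x) → Integral (g n * ι y) →
        Integral (g (suc n) * ι (x ℚ.* 0ℚ ℚ.+ y ℚ.* 1ℚ)) ×
        Integral (g (suc n) * ι (x ℚ.* 1ℚ ℚ.+ y ℚ.* a (suc n)))
      column-integral n x y h k =
        mod-cong (sym (g-column₁ n x y)) (mod-neg (mod-* k (A-integral n))) ,
        mod-cong (sym (g-column₂ n x y)) (mod-neg (mod-+ (mod-* h (A-integral n))
          (mod-* k (mod-minus (mod-1 0) (mod-* (A-integral n) (A-integral (suc n)))))))

      g*fromInt-integral : ∀ i → Integral (g 0 * ι (fromInt i))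
      g*fromInt-integral i = integral _ (mod-* (mod-neg (mod-1 0)) (mod-ι i 0))

      gp-integral : ∀ n → Integral (g n * ι (m₁₁ (M n))) × Integral (g n * ι (m₁₂ (M n)))
      gp-integral zero    = g*fromInt-integral 1ℤ , g*fromInt-integral 0ℤ
      gp-integral (suc n) = let h , k = gp-integral n in column-integral n _ _ h k

      gq-integral : ∀ n → Integral (g n * ι (m₂₁ (M n))) × Integral (g n * ι (m₂₂ (M n)))
      gq-integral zero    = g*fromInt-integral 0ℤ , g*fromInt-integral 1ℤ
      gq-integral (suc n) = let h , k = gq-integral n in column-integral n _ _ h k

      -- The first product need not be even without the factor A n, which may be a unit. With it,
      -- the next value contains A n A (n + 1), which is even. In the second product all terms but
      -- one are then even, leaving -1, the same as 1 modulo 2.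
      gq-odd : ∀ n → (g n * ι (m₂₁ (M n)) * A n ≋ 0ℤ [2^ 1 ]) × (g n * ι (m₂₂ (M n)) ≋ 1ℤ [2^ 1 ])
      gq-odd zero =
        mod-cong (solve 2 (λ x y → con 0ℚ := x :* con 0ℚ :* y) refl (g 0) (A 0)) (mod-ι 0ℤ 1) ,
        mod-shift (divides (ℤ.- 1ℤ) ≡.refl) (mod-* (mod-neg (mod-1 1)) (mod-ι 1ℤ 1))
      gq-odd (suc n) = let h , k = gq-odd n; x = m₂₁ (M n); y = m₂₂ (M n) in
        mod-cong (sym (trans (*-congʳ (g-column₁ n x y))
          (solve 3 (λ u A B → :- (u :* A) :* B := :- (u :* (A :* B))) refl (g n * ι y) (A n) (A (suc n)))))
          (mod-neg (mod-* k (A-even n))) ,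
        mod-cong (sym (g-column₂ n x y)) (mod-shift (divides (ℤ.- 1ℤ) ≡.refl)
          (mod-neg (mod-+ h (mod-* k (mod-minus (mod-1 1) (A-even n))))))

      denom≢0 : ∀ n → NonZero (denom a n)
      denom≢0 n = ℚ.≢-nonZero λ q≡0 → contradiction
        (Div.∣⇒∣ᵤ (mod-unique (proj₂ (gq-odd n))
          (mod-cong (trans (sym (zeroʳ (g n))) (*-congˡ (trans (sym ι-0) (ι-cong (≡.sym q≡0))))) (mod-0 1))))
        λ d → contradiction (ℕ.∣1⇒≡1 d) λ ()

      column-dyadic : ∀ n {x y} → Dyadic x → Dyadic y →
        Dyadic (x ℚ.* 0ℚ ℚ.+ y ℚ.* 1ℚ) × Dyadic (x ℚ.* 1ℚ ℚ.+ y ℚ.* a (suc n))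
      column-dyadic n h k =
        Dyadic-+ (Dyadic-* h (Dyadic-fromInt 0ℤ)) (Dyadic-* k (Dyadic-fromInt 1ℤ)) ,
        Dyadic-+ (Dyadic-* h (Dyadic-fromInt 1ℤ)) (Dyadic-* k (step-dyadic (step′ n)))

      p-dyadic : ∀ n → Dyadic (m₁₁ (M n)) × Dyadic (m₁₂ (M n))
      p-dyadic zero    = Dyadic-fromInt 1ℤ , Dyadic-fromInt 0ℤ
      p-dyadic (suc n) = let h , k = p-dyadic n in column-dyadic n h k

      q-dyadic : ∀ n → Dyadic (m₂₁ (M n)) × Dyadic (m₂₂ (M n))
      q-dyadic zero    = Dyadic-fromInt 0ℤ , Dyadic-fromInt 1ℤ
      q-dyadic (suc n) = let h , k = q-dyadic n in column-dyadic n h k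

      -- The integrality lemmas pair pₙ and qₙ with g n, whereas qₙ α - pₙ is g (n + 1). The
      -- difference is the integral factor - A n.
      next-integral : ∀ n {x} → Integral (g n * x) →
        Integral ((ι (denom a n) * α - ι (numer a n)) * x)
      next-integral n {x} h = mod-cong
        (trans (solve 3 (λ g x A → :- (g :* x :* A) := :- (g :* A) :* x) refl (g n) x (A n))
               (*-congʳ (proj₂ (g≈qα-p n))))
        (mod-neg (mod-* h (A-integral n)))

      convergence : ¬ IsRational α →
        (λ n → fromℚ (_÷_ (numer a n) (denom a n) {{denom≢0 n}})) ⟶ σ∞ α
      convergence α∉ℚ =
        -- These constants depend on α alone, so one threshold works for all convergents.
        let t , ν , α[t-α]≈ν = quadratic-relation α∉ℚ in
        go α[t-α]≈ν (bound-exists (ι t - (α + α))) (common-denominator t ν)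
        where
        go : ∀ {t ν} → α * (ι t - α) ≈ ι ν → ∃ (λ T → 0ℚ ℚ.≤ T × Bound (ι t - (α + α)) T) →
          ∃ (λ d → ¬ fromInt d ≡ 0ℚ ×
            (∃₂ λ i j → fromInt d ℚ.* t ≡ fromInt i × fromInt d ℚ.* ν ≡ fromInt j)) →
          (λ n → fromℚ (_÷_ (numer a n) (denom a n) {{denom≢0 n}})) ⟶ σ∞ α
        go α[t-α]≈ν (T , 0≤T , T-bound) (d , C≢0 , i , j , Ct≡i , Cν≡j) ε 0<ε =
          -- The weight |C| (T + ε) is the one from the refutation of ε |q| ≤ b.
          let N , small = decay→0 (∣ fromInt d ∣ ℚ.* (T ℚ.+ ε))
                (0≤* (ℚ.0≤∣p∣ (fromInt d)) (ℚ.+-mono-≤ 0≤T (ℚ.<⇒≤ 0<ε))) 0<ε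
          in N , λ n N≤n →
            Approximation.quotient-close α∉ℚ (mod-cong α₁≈α (A-integral 0)) α[t-α]≈ν {T} 0≤T T-bound
              {fromInt d} C≢0 {d} {i} {j} ≡.refl Ct≡i Cν≡j (numer a n) (denom a n) {{denom≢0 n}}
              (proj₂ (p-dyadic n)) (proj₂ (q-dyadic n))
              (next-integral n (proj₂ (gp-integral n))) (next-integral n (proj₂ (gq-integral n)))
              (0≤decay (suc n)) (decay≤1 (suc n)) (bound-cong (proj₂ (g≈qα-p n)) (g-bound (suc n)))
              0<ε (small (suc n) (ℕ.m≤n⇒m≤1+n N≤n))

theorem3p13 : ∀ {c ℓ} (K : QuadraticField c ℓ) →
    let open QuadraticField K in
    (σ∞ : Carrier → ℝ) → RealEmbedding K σ∞ →
    (σ₂ : Carrier → ℚ₂) → 2-AdicEmbedding K σ₂ →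
    let open Algorithm K σ∞ σ₂ in
    (α : Carrier) → ¬ IsRational α → PropertyI α →
    (a : ℕ → ℚ) (αs : ℕ → Carrier) → IsExpansion α a αs →
    Σ (∀ n → NonZero (denom a n)) λ q≢0 →
    (λ n → fromℚ (_÷_ (numer a n) (denom a n) {{q≢0 n}})) ⟶ σ∞ α
theorem3p13 K σ∞ σ∞-mono σ₂ σ₂-mono α α∉ℚ α∈I a αs expansion =
  Convergence.Embedded.Expansion.denom≢0 K σ∞ σ∞-mono σ₂ σ₂-mono α∈I expansion ,
  Convergence.Embedded.Expansion.convergence K σ∞ σ∞-mono σ₂ σ₂-mono α∈I expansion α∉ℚ
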